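{- Let $H$ be a graph, and let $h \in V(H)$ be a vertex of $H$ that has no neighbor of degree one. If $G$ is a graph that does not contain $H$ as a minor, then $s(G) \leq 3|E(H - h)|$. If $G$ is also bipartite, then $s(G) \leq 2|E(H-h)|$. Here $s(G)$ is the surrounding cop number of $G$.
   Context: $H-h$ denotes the graph obtained from $H$ by deleting the vertex $h$, and $E(H-h)$ is its edge set. A graph $H$ is a minor of $G$ if it can be obtained from $G$ by deleting vertices, deleting edges and contracting edges. Surrounding Cops and Robbers is a perfect-information game played on a finite graph $G$ by two players. The first player controls a team of cops $C_1,\dots,C_m$; the second controls one robber. Initially, the first player places each cop on some vertex of $G$, and then the second player places the robber on some vertex of $G$. Then the two players alternate in taking turns. On the first player's turn, she moves each cop to an adjacent vertex or leaves it at its current vertex. On the second player's turn, he moves the robber to an adjacent vertex or leaves the robber at its current vertex. Two cops may occupy the same vertex, and a cop and the robber may occupy the same vertex, but the second player may not end a turn with the robber on the same vertex as a cop. The first player wins if at any point the robber occupies a vertex $r$ such that each neighbor of $r$ is occupied by a cop (the robber is surrounded). The second player wins by indefinitely preventing the first player from winning. The surrounding cop number $s(G)$ of a finite graph $G$ is the minimum $m$ such that the first player, with a team of $m$ cops, has a winning strategy on $G$.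
   Formalization: G is assumed connected (H = K_3 and G four disjoint edges refute the claim otherwise), and H is assumed to have no isolated vertex other than possibly h (H = K_3 plus three isolated vertices, h in the K_3, and G = K_5 refute it otherwise). -}

module Defs where

open import Level using (0ℓ)
open import Data.Bool using (Bool)
open import Data.Nat using (ℕ; zero; suc; _≤_; _<_; z≤n; s≤s; s≤s⁻¹)
open import Data.Nat.Properties using (n≮0; <-≤-trans; ≤-refl)
open import Data.Fin as Fin using (Fin; punchIn)
open import Data.Fin.Properties as Fin using (all?; any?)
open import Data.List using (List; []; _∷_; allFin; cartesianProduct;
  cartesianProductWith; filter; length)
open import Data.List.Properties using (filter-notAll)
import Data.List.Relation.Unary.Any as Any
open import Data.List.Membership.Propositional using (_∈_; _∉_; find; lose)
open import Data.List.Membership.Propositional.Properties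
  using (∈-allFin; ∈-cartesianProduct⁺; ∈-cartesianProductWith⁺; ∈-filter⁺)
open import Data.Vec as Vec using (Vec; []; _∷_; lookup)
open import Data.Vec.Properties as Vec using (lookup-allFin)
open import Data.Product using (_×_; _,_; proj₁; proj₂; ∃; ∃-syntax)
open import Data.Product.Properties as Product using ()
open import Data.Sum using (_⊎_; inj₁; inj₂; swap)
open import Data.Empty using (⊥-elim)
open import Function using (_∘_; _⇔_; _↔_; Inverse)
open import Relation.Binary using (Rel; Decidable; DecidableEquality)
open import Relation.Binary.Construct.Closure.ReflexiveTransitive using (Star)
open import Relation.Binary.PropositionalEquality
  using (_≡_; _≢_; refl; sym)
open import Relation.Nullary using (¬_; Dec; yes; no; map′)
open import Relation.Nullary.Decidable using (_×-dec_; _⊎-dec_; _→-dec_; ¬?)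
open import Relation.Unary as Unary using (Pred)

record Graph (n : ℕ) : Set₁ where
  infix 4 _~_ _~?_
  field
    _~_      : Rel (Fin n) 0ℓ
    _~?_     : Decidable _~_
    ~-sym    : ∀ {u v} → u ~ v → v ~ u
    ~-irrefl : ∀ {v} → ¬ (v ~ v)

open Graph

infix 4 _[_~_]
_[_~_] : ∀ {n} → Graph n → Fin n → Fin n → Set
G [ u ~ v ] = _~_ G u v

degree : ∀ {n} → Graph n → Fin n → ℕ
degree {n} G v = length (filter (_~?_ G v) (allFin n))

-- Each edge is listed once, as the pair of its ends in increasing order.
edges : ∀ {n} → Graph n → List (Fin n × Fin n)
edges {n} G =
  filter (λ e → (proj₁ e Fin.<? proj₂ e) ×-dec _~?_ G (proj₁ e) (proj₂ e))
         (cartesianProduct (allFin n) (allFin n))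

-- The empty graph counts as connected.
Connected : ∀ {n} → Graph n → Set
Connected G = ∀ u v → Star (_~_ G) u v

Bipartite : ∀ {n} → Graph n → Set
Bipartite {n} G =
  ∃ λ (side : Fin n → Bool) → ∀ u v → G [ u ~ v ] → side u ≢ side v

record _≅_ {m n} (H : Graph m) (G : Graph n) : Set where
  field
    bijection : Fin m ↔ Fin n
    preserves : ∀ u v → H [ u ~ v ] ⇔
                        G [ Inverse.to bijection u ~ Inverse.to bijection v ]

-- After removal of v, the vertex i : Fin n stands for punchIn v i.
deleteVertex : ∀ {n} → Graph (suc n) → Fin (suc n) → Graph n
deleteVertex G v = record
  { _~_      = λ i j → G [ punchIn v i ~ punchIn v j ]
  ; _~?_     = λ i j → _~?_ G (punchIn v i) (punchIn v j)
  ; ~-sym    = ~-sym G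
  ; ~-irrefl = ~-irrefl G
  }

deleteEdge : ∀ {n} → Graph n → Fin n → Fin n → Graph n
deleteEdge G u v = record
  { _~_      = λ i j → G [ i ~ j ] × ¬ ((i ≡ u × j ≡ v) ⊎ (i ≡ v × j ≡ u))
  ; _~?_     = λ i j → _~?_ G i j ×-dec
                 ¬? (((i Fin.≟ u) ×-dec (j Fin.≟ v)) ⊎-dec
                     ((i Fin.≟ v) ×-dec (j Fin.≟ u)))
  ; ~-sym    = λ (a , ¬e) → ~-sym G a , λ
                 { (inj₁ (p , q)) → ¬e (inj₂ (q , p))
                 ; (inj₂ (p , q)) → ¬e (inj₁ (q , p)) }
  ; ~-irrefl = ~-irrefl G ∘ proj₁
  }

-- Identifies v with u: the vertex v disappears, u inherits its neighbours, and
-- loops and parallel edges are discarded.  Vertices are named as in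
-- deleteVertex G v.
identify : ∀ {n} → Graph (suc n) → (u v : Fin (suc n)) → Graph n
identify G u v = record
  { _~_      = λ i j → i ≢ j × Joined (punchIn v i) (punchIn v j)
  ; _~?_     = λ i j → ¬? (i Fin.≟ j) ×-dec joined? (punchIn v i) (punchIn v j)
  ; ~-sym    = λ (i≢j , e) → i≢j ∘ sym , joined-sym e
  ; ~-irrefl = λ (i≢i , _) → i≢i refl
  }
  where
  Joined : Rel _ 0ℓ
  Joined x y = G [ x ~ y ] ⊎ (x ≡ u × G [ v ~ y ]) ⊎ (y ≡ u × G [ v ~ x ])

  joined? : Decidable Joined
  joined? x y = _~?_ G x y ⊎-dec
    ((x Fin.≟ u) ×-dec _~?_ G v y) ⊎-dec ((y Fin.≟ u) ×-dec _~?_ G v x)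

  joined-sym : ∀ {x y} → Joined x y → Joined y x
  joined-sym (inj₁ e) = inj₁ (~-sym G e)
  joined-sym (inj₂ e) = inj₂ (swap e)

infix 4 _IsMinorOf_
data _IsMinorOf_ {m} (H : Graph m) : ∀ {n} → Graph n → Set₁ where
  isomorphic    : ∀ {n} {G : Graph n} → H ≅ G → H IsMinorOf G
  delete-vertex : ∀ {n} {G : Graph (suc n)} v →
                  H IsMinorOf deleteVertex G v → H IsMinorOf G
  delete-edge   : ∀ {n} {G : Graph n} {u v} → G [ u ~ v ] →
                  H IsMinorOf deleteEdge G u v → H IsMinorOf G
  contract-edge : ∀ {n} {G : Graph (suc n)} {u v} → G [ u ~ v ] →
                  H IsMinorOf identify G u v → H IsMinorOf G

data Turn : Set where
  cops robber : Turn

module _ {n : ℕ} (G : Graph n) where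

  Step : Rel (Fin n) 0ℓ
  Step u v = u ≡ v ⊎ G [ u ~ v ]

  module _ {m : ℕ} where

    Occupied : Vec (Fin n) m → Fin n → Set
    Occupied c v = ∃[ i ] lookup c i ≡ v

    Surrounded : Vec (Fin n) m → Fin n → Set
    Surrounded c r = ∀ v → G [ r ~ v ] → Occupied c v

    Moves : Rel (Vec (Fin n) m) 0ℓ
    Moves c c′ = ∀ i → Step (lookup c i) (lookup c′ i)

    RobberMoves : Vec (Fin n) m → Rel (Fin n) 0ℓ
    RobberMoves c r r′ = Step r r′ × ¬ Occupied c r′

    -- CopsWin t c r: winning strategies for the cops from the position with
    -- cops at c, robber at r and t to move, as well-founded strategy trees
    -- (every play following the tree surrounds the robber after finitely many
    -- turns).
    -- A robber who is not surrounded always has a legal move, so robber-moves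
    -- does not let the cops win by stalemate.
    data CopsWin : Turn → Vec (Fin n) m → Fin n → Set where
      surrounded   : ∀ {t c r} → Surrounded c r → CopsWin t c r
      cops-move    : ∀ {c r} c′ → Moves c c′ →
                     CopsWin robber c′ r → CopsWin cops c r
      robber-moves : ∀ {c r} → (∀ r′ → RobberMoves c r r′ → CopsWin cops c r′) →
                     CopsWin robber c r

  -- The robber may not be placed on an occupied vertex.
  CopsHaveWinningStrategy : ℕ → Set
  CopsHaveWinningStrategy m =
    ∃[ c ] (∀ r → ¬ Occupied {m} c r → CopsWin cops c r)

  -- The decision procedure for the game: starting from the list of all
  -- positions with the cops to move, remove those already seen to be won until
  -- no more can be removed.

  allVecs : ∀ m → List (Vec (Fin n) m)
  allVecs zero    = [] ∷ []
  allVecs (suc m) = cartesianProductWith _∷_ (allFin n) (allVecs m)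

  ∈-allVecs : ∀ {m} (c : Vec (Fin n) m) → c ∈ allVecs m
  ∈-allVecs []      = Any.here refl
  ∈-allVecs (x ∷ c) = ∈-cartesianProductWith⁺ _∷_ (∈-allFin x) (∈-allVecs c)

  anyVec? : ∀ {m} {P : Pred (Vec (Fin n) m) 0ℓ} → Unary.Decidable P → Dec (∃ P)
  anyVec? {m} P? = map′ (λ p → let (c , _ , pc) = find p in c , pc)
                        (λ (c , pc) → lose (∈-allVecs c) pc)
                        (Any.any? P? (allVecs m))

  step? : Decidable Step
  step? u v = (u Fin.≟ v) ⊎-dec _~?_ G u v

  module _ {m : ℕ} where

    occupied? : Decidable (Occupied {m})
    occupied? c v = any? λ i → lookup c i Fin.≟ v

    surrounded? : Decidable (Surrounded {m})
    surrounded? c r = all? λ v → _~?_ G r v →-dec occupied? c v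

    private
      Position : Set
      Position = Vec (Fin n) m × Fin n

      _≟ₚ_ : DecidableEquality Position
      _≟ₚ_ = Product.≡-dec (Vec.≡-dec Fin._≟_) Fin._≟_

      open import Data.List.Membership.DecPropositional _≟ₚ_ using (_∈?_)

      Win : Pred Position 0ℓ
      Win (c , r) = CopsWin cops c r

      Round : Pred Position 0ℓ → Pred Position 0ℓ
      Round D (c , r) = Surrounded c r ⊎ ∃[ c′ ] (Moves c c′ ×
        (Surrounded c′ r ⊎ (∀ r′ → RobberMoves c′ r r′ → D (c′ , r′))))

      round? : ∀ {D} → Unary.Decidable D → Unary.Decidable (Round D)
      round? D? (c , r) = surrounded? c r ⊎-dec anyVec? λ c′ →
        all? (λ i → step? (lookup c i) (lookup c′ i)) ×-dec
        (surrounded? c′ r ⊎-dec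
         all? λ r′ → (step? r r′ ×-dec ¬? (occupied? c′ r′)) →-dec D? (c′ , r′))

      round-sound : ∀ {D} → (∀ {p} → D p → Win p) → ∀ {p} → Round D p → Win p
      round-sound D⊆ (inj₁ s)                 = surrounded s
      round-sound D⊆ (inj₂ (c′ , m , inj₁ s)) = cops-move c′ m (surrounded s)
      round-sound D⊆ (inj₂ (c′ , m , inj₂ f)) =
        cops-move c′ m (robber-moves λ r′ s → D⊆ (f r′ s))

      closed-complete : ∀ {D} → (∀ {p} → Round D p → D p) → ∀ {p} → Win p → D p
      closed-complete cl (surrounded s) = cl (inj₁ s)
      closed-complete cl (cops-move c′ m (surrounded s)) =
        cl (inj₂ (c′ , m , inj₁ s))
      closed-complete cl (cops-move c′ m (robber-moves f)) =
        cl (inj₂ (c′ , m , inj₂ λ r′ s → closed-complete cl (f r′ s)))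

      decide : ∀ fuel U → length U < fuel →
               (∀ {p} → p ∉ U → Win p) → Unary.Decidable Win
      decide zero       U len sound = ⊥-elim (n≮0 len)
      decide (suc fuel) U len sound
        with Any.any? (round? (λ p → ¬? (p ∈? U))) U
      ... | no stable = λ p →
        map′ sound (closed-complete closed) (¬? (p ∈? U))
        where
        closed : ∀ {p} → Round (_∉ U) p → p ∉ U
        closed rd p∈U = stable (lose p∈U rd)
      ... | yes found = decide fuel U′ shorter sound′
        where
        q      = proj₁ (find found)
        q∈U    = proj₁ (proj₂ (find found))
        q-wins = round-sound sound (proj₂ (proj₂ (find found)))

        U′ : List Position
        U′ = filter (λ p → ¬? (p ≟ₚ q)) U

        shorter : length U′ < fuel
        shorter = <-≤-trans
          (filter-notAll (λ p → ¬? (p ≟ₚ q)) U (lose q∈U λ q≢q → q≢q refl))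
          (s≤s⁻¹ len)

        sound′ : ∀ {p} → p ∉ U′ → Win p
        sound′ {p} p∉U′ with p ≟ₚ q
        ... | yes refl = q-wins
        ... | no p≢q   = sound λ p∈U → p∉U′ (∈-filter⁺ _ p∈U p≢q)

    copsWin? : ∀ c r → Dec (CopsWin {m} cops c r)
    copsWin? c r = decide _ all ≤-refl (λ p∉ → ⊥-elim (p∉ (∈-all _))) (c , r)
      where
      all : List (Vec (Fin n) m × Fin n)
      all = cartesianProduct (allVecs m) (allFin n)

      ∈-all : ∀ p → p ∈ all
      ∈-all (c , r) = ∈-cartesianProduct⁺ (∈-allVecs c) (∈-allFin r)

  copsHaveWinningStrategy? : Unary.Decidable CopsHaveWinningStrategy
  copsHaveWinningStrategy? m =
    anyVec? λ c → all? λ r → ¬? (occupied? c r) →-dec copsWin? c r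

  n-cops-win : CopsHaveWinningStrategy n
  n-cops-win = Vec.allFin n , λ r free → ⊥-elim (free (r , lookup-allFin r))

IsMinimum : Pred ℕ 0ℓ → Pred ℕ 0ℓ
IsMinimum P s = P s × (∀ m → P m → s ≤ m)

minimum : ∀ {P : Pred ℕ 0ℓ} → Unary.Decidable P → ∀ n → P n → ∃ (IsMinimum P)
minimum P? n pn with P? zero
... | yes p0 = zero , p0 , λ _ _ → z≤n
minimum P? zero    pn | no ¬p0 = ⊥-elim (¬p0 pn)
minimum P? (suc n) pn | no ¬p0 with minimum (P? ∘ suc) n pn
... | s , ps , least = suc s , ps , λ
  { zero    p0 → ⊥-elim (¬p0 p0)
  ; (suc m) pm → s≤s (least m pm) }

abstract
  surroundingCopNumber-exists :
    ∀ {n} (G : Graph n) → ∃ (IsMinimum (CopsHaveWinningStrategy G))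
  surroundingCopNumber-exists {n} G =
    minimum (copsHaveWinningStrategy? G) n (n-cops-win G)

surroundingCopNumber : ∀ {n} → Graph n → ℕ
surroundingCopNumber G = proj₁ (surroundingCopNumber-exists G)

surroundingCopNumber-isMinimum : ∀ {n} (G : Graph n) →
  IsMinimum (CopsHaveWinningStrategy G) (surroundingCopNumber G)
surroundingCopNumber-isMinimum G = proj₂ (surroundingCopNumber-exists G)

{-# OPTIONS --safe #-}
module Submission where

-- Each edge of H − h has a team of cops, which guards nothing, a vertex or a
-- stretch of a geodesic.  The robber is confined to a connected territory R, whose boundary
-- is guarded.  Disjoint connected "bags", one per vertex of H − h, are kept
-- outside R; a team guarding a path between the bags of the two ends of its
-- edge, with both end vertices of the path adjacent to R, realises this edge,
-- and a path that stops being adjacent to R is trimmed from its ends, which are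
-- absorbed by the bags.  If every edge is realised then the bags together with
-- R, as the branch set of h, give an H minor.  Otherwise some team guards at
-- most one vertex z.  It can then occupy a vertex of R, or, without ever giving
-- up z, extend its guard to a geodesic of R ∪ {z} from z to the bag of the other
-- end, restarting this bag if it is not adjacent to R.  Each time R shrinks.
--
-- A geodesic is guarded by following the robber's shadow (his distance from the
-- start) at distance −1, 0 and +1.  In a bipartite graph the robber cannot step
-- from distance d onto the d-th vertex of the path, so the cop in the middle is
-- not needed.

open import Level using (0ℓ)
open import Data.Bool using (not)
open import Data.Bool.Properties using (¬-not)
open import Data.Nat using (ℕ; zero; suc; _+_; _*_; _∸_; _⊓_; _⊔_; _≤_; _<_; z≤n; s≤s; s≤s⁻¹; _≤?_; _<?_)
open import Data.Nat.Induction using (<-wellFounded)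
open import Data.Nat.Properties as ℕ using (anyUpTo?)
open import Data.Fin as Fin using (Fin; zero; suc; punchIn; punchOut; combine; remQuot)
open import Data.Fin.Properties as Fin
  using (any?; punchIn-punchOut; punchInᵢ≢i; punchIn-injective; punchOut-punchIn; remQuot-combine)
open import Data.Fin.Subset as Subset using (Subset; _∈_; _∉_; _⊆_; ⁅_⁆; _∪_; ∣_∣)
open import Data.Fin.Subset.Properties
  using (_∈?_; ∈⊤; x∈⁅x⁆; x∈⁅y⁆⇒x≡y; x∈p∪q⁻; x∈p∪q⁺; p⊆p∪q; ∣p∣≤n; p⊂q⇒∣p∣<∣q∣)
open import Data.List as List using (List; []; _∷_; length; allFin; cartesianProduct; filter)
open import Data.List.Membership.Propositional as List using ()
open import Data.List.Membership.Propositional.Properties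
  using (∈-allFin; ∈-cartesianProduct⁺; ∈-lookup; ∈-filter⁺; ∈-filter⁻)
open import Data.List.Relation.Unary.All using (_∷_)
open import Data.List.Relation.Unary.AllPairs using (_∷_)
open import Data.List.Relation.Unary.Any using (here; there; index)
open import Data.List.Relation.Unary.Any.Properties using (lookup-index)
open import Data.List.Relation.Unary.Unique.Propositional using (Unique)
open import Data.List.Relation.Unary.Unique.Propositional.Properties using (allFin⁺; filter⁺)
open import Data.Maybe using (Maybe; just; nothing)
open import Data.Maybe.Properties using (just-injective; ≡-dec)
open import Data.Product using (_×_; _,_; proj₁; proj₂; ∃; ∃₂)
open import Data.Product.Properties using (,-injective)
open import Data.Product.Relation.Binary.Lex.Strict using (×-Lex; ×-wellFounded)
open import Data.Sum using (_⊎_; inj₁; inj₂; [_,_])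
open import Data.Empty using (⊥; ⊥-elim)
open import Data.Unit using (⊤; tt)
open import Data.Vec using (Vec; []; lookup; tabulate)
open import Data.Vec.Properties using (lookup∘tabulate)
open import Data.Vec.Functional using (updateAt)
open import Data.Vec.Functional.Properties using (updateAt-updates; updateAt-minimal)
open import Function using (_∘_; const; id; mk⇔; mk↔ₛ′)
open import Induction.WellFounded using (WellFounded; Acc; acc)
open import Relation.Binary using (Rel; Tri; tri<; tri≈; tri>)
open import Relation.Binary.Construct.Closure.ReflexiveTransitive
  using (Star; ε; _◅_; _◅◅_; gmap; reverse)
open import Relation.Binary.Construct.On as On using ()
open import Relation.Binary.PropositionalEquality hiding ([_])
open import Relation.Nullary using (¬_; Dec; yes; no)
open import Relation.Nullary.Decidable using (_×-dec_; ¬?; decidable-stable)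
open import Relation.Unary using (Pred; Decidable)
open import Defs
open Graph hiding (_~_)

-- Minors from branch sets

Within : ∀ {n} → Graph n → Pred (Fin n) 0ℓ → Rel (Fin n) 0ℓ
Within G P u v = P u × P v × G [ u ~ v ]

ConnectedOn : ∀ {n} → Graph n → Pred (Fin n) 0ℓ → Set
ConnectedOn G P = ∀ {u v} → P u → P v → Star (Within G P) u v

-- Branch sets are encoded by the partial map sending each vertex of G to the
-- vertex of H whose branch set contains it.
record Model {k n} (H : Graph k) (G : Graph n) (f : Fin n → Maybe (Fin k)) : Set where
  field
    inhabited : ∀ x → ∃ λ v → f v ≡ just x
    connected : ∀ x → ConnectedOn G (λ v → f v ≡ just x)
    adjacent  : ∀ {x y} → H [ x ~ y ] →
                ∃₂ λ u v → f u ≡ just x × f v ≡ just y × G [ u ~ v ]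

module _ {k n} {H : Graph k} (to : Fin k → Fin n) (from : Fin n → Fin k)
         (to-from : ∀ v → to (from v) ≡ v) (from-to : ∀ x → from (to x) ≡ x) where

  -- `ps` holds the pairs still to be inspected; an edge of `G` outside it is known to come from
  -- `H`. A pair that is an edge of `G` without counterpart in `H` is deleted.
  spanning⇒minor : ∀ {G : Graph n} (ps : List (Fin n × Fin n)) →
    (∀ {x y} → H [ x ~ y ] → G [ to x ~ to y ]) →
    (∀ {u v} → G [ u ~ v ] → (u , v) List.∉ ps → H [ from u ~ from v ]) →
    H IsMinorOf G
  spanning⇒minor {G} [] emb back = isomorphic record
    { bijection = mk↔ₛ′ to from to-from from-to
    ; preserves = λ x y → mk⇔ emb
        λ e → subst₂ (Graph._~_ H) (from-to x) (from-to y) (back e λ ()) }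
  spanning⇒minor {G} ((u , v) ∷ ps) emb back
    with _~?_ G u v ×-dec ¬? (_~?_ H (from u) (from v))
  ... | yes (uv , ¬xy) = delete-edge uv (spanning⇒minor ps emb′ back′)
    where
    emb′ : ∀ {x y} → H [ x ~ y ] → deleteEdge G u v [ to x ~ to y ]
    emb′ {x} {y} xy = emb xy , λ
      { (inj₁ (refl , refl)) → ¬xy (subst₂ (Graph._~_ H) (sym (from-to x)) (sym (from-to y)) xy)
      ; (inj₂ (refl , refl)) → ¬xy (subst₂ (Graph._~_ H) (sym (from-to y)) (sym (from-to x)) (~-sym H xy)) }

    back′ : ∀ {a b} → deleteEdge G u v [ a ~ b ] → (a , b) List.∉ ps → H [ from a ~ from b ]
    back′ (ab , ¬uv) ∉ps = back ab λ
      { (here refl) → ¬uv (inj₁ (refl , refl))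
      ; (there ∈ps) → ∉ps ∈ps }
  ... | no ¬extra = spanning⇒minor ps emb back′
    where
    back′ : ∀ {a b} → G [ a ~ b ] → (a , b) List.∉ ps → H [ from a ~ from b ]
    back′ {a} {b} ab ∉ps with _~?_ H (from a) (from b)
    ... | yes xy = xy
    ... | no ¬xy = back ab λ
      { (here refl) → ¬extra (ab , ¬xy)
      ; (there ∈ps) → ∉ps ∈ps }

bijective-model⇒minor : ∀ {k n} {H : Graph k} {G : Graph n} {f} → Model H G f →
  (∀ v → ∃ λ x → f v ≡ just x) → (∀ {u v} → f u ≡ f v → u ≡ v) → H IsMinorOf G
bijective-model⇒minor {H = H} {G} {f} M total inj =
  -- With all pairs on the list, nothing has to be known about the edges of `G` at the start.
  spanning⇒minor to from to-from from-to (cartesianProduct (allFin _) (allFin _))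
    emb (λ _ ∉all → ⊥-elim (∉all (∈-cartesianProduct⁺ (∈-allFin _) (∈-allFin _))))
  where
  to   = proj₁ ∘ Model.inhabited M
  from = proj₁ ∘ total

  to-from : ∀ v → to (from v) ≡ v
  to-from v = inj (trans (proj₂ (Model.inhabited M (from v))) (sym (proj₂ (total v))))

  from-to : ∀ x → from (to x) ≡ x
  from-to x = just-injective
    (trans (sym (proj₂ (total (to x)))) (proj₂ (Model.inhabited M x)))

  emb : ∀ {x y} → H [ x ~ y ] → G [ to x ~ to y ]
  emb {x} {y} xy with Model.adjacent M xy
  ... | u , v , fu , fv , uv = subst₂ (Graph._~_ G)
    (inj (trans fu (sym (proj₂ (Model.inhabited M x)))))
    (inj (trans fv (sym (proj₂ (Model.inhabited M y))))) uv

delete-unused : ∀ {k n} {H : Graph k} {G : Graph (suc n)} {f} → Model H G f →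
  ∀ {v} → f v ≡ nothing → Model H (deleteVertex G v) (f ∘ punchIn v)
delete-unused {H = H} {G} {f} M {v} fv = record
  { inhabited = λ x → let u , fu = Model.inhabited M x; i , eq = used fu in
      i , trans (cong f eq) fu
  ; connected = λ x fi fj → walk (Model.connected M x fi fj) refl refl
  ; adjacent  = adj
  }
  where
  used : ∀ {x u} → f u ≡ just x → ∃ λ i → punchIn v i ≡ u
  used {u = u} fu = punchOut v≢u , punchIn-punchOut v≢u
    where
    v≢u : v ≢ u
    v≢u refl with trans (sym fv) fu
    ... | ()

  walk : ∀ {x a b i j} → Star (Within G (λ w → f w ≡ just x)) a b →
         punchIn v i ≡ a → punchIn v j ≡ b →
         Star (Within (deleteVertex G v) (λ w → f (punchIn v w) ≡ just x)) i j
  walk {i = i} {j} ε refl eq rewrite punchIn-injective v j i eq = ε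
  walk ((fa , fc , ac) ◅ cb) refl refl with used fc
  ... | _ , refl = (fa , fc , ac) ◅ walk cb refl refl

  adj : ∀ {x y} → H [ x ~ y ] → ∃₂ λ i j →
        f (punchIn v i) ≡ just x × f (punchIn v j) ≡ just y × deleteVertex G v [ i ~ j ]
  adj xy with Model.adjacent M xy
  ... | a , b , fa , fb , ab with used fa | used fb
  ... | i , refl | j , refl = i , j , fa , fb , ab

contract-within : ∀ {k n} {H : Graph k} {G : Graph (suc n)} {f} → Model H G f →
  ∀ {u v} → f u ≡ f v → G [ u ~ v ] → Model H (identify G u v) (f ∘ punchIn v)
contract-within {H = H} {G} {f} M {u} {v} fuv uv = record
  { inhabited = λ x → let w , fw = Model.inhabited M x in ρ w , trans (f-ρ w) fw
  ; connected = λ x {i} {j} fi fj → subst₂ (Star _) (ρ-punchIn i) (ρ-punchIn j)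
                  (walk (Model.connected M x fi fj))
  ; adjacent  = adj
  }
  where
  v≢u : v ≢ u
  v≢u refl = ~-irrefl G uv

  -- The quotient map of the contraction: `v` goes to the new name of `u`, every other vertex to its
  -- own new name.
  ρ : Fin _ → Fin _
  ρ w with v Fin.≟ w
  ... | yes _  = punchOut v≢u
  ... | no v≢w = punchOut v≢w

  f-ρ : ∀ w → f (punchIn v (ρ w)) ≡ f w
  f-ρ w with v Fin.≟ w
  ... | yes refl = trans (cong f (punchIn-punchOut v≢u)) fuv
  ... | no v≢w   = cong f (punchIn-punchOut v≢w)

  ρ-punchIn : ∀ i → ρ (punchIn v i) ≡ i
  ρ-punchIn i with v Fin.≟ punchIn v i
  ... | yes eq = ⊥-elim (punchInᵢ≢i v i (sym eq))
  ... | no _   = punchOut-punchIn v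

  ρ-edge : ∀ {a b} → G [ a ~ b ] → ρ a ≢ ρ b → identify G u v [ ρ a ~ ρ b ]
  ρ-edge {a} {b} ab ρa≢ρb = ρa≢ρb , joined
    where
    joined : G [ punchIn v (ρ a) ~ punchIn v (ρ b) ]
           ⊎ (punchIn v (ρ a) ≡ u × G [ v ~ punchIn v (ρ b) ])
           ⊎ (punchIn v (ρ b) ≡ u × G [ v ~ punchIn v (ρ a) ])
    joined with v Fin.≟ a | v Fin.≟ b
    ... | yes refl | yes refl = ⊥-elim (~-irrefl G ab)
    ... | yes refl | no v≢b   = inj₂ (inj₁ (punchIn-punchOut v≢u ,
                                  subst (Graph._~_ G v) (sym (punchIn-punchOut v≢b)) ab))
    ... | no v≢a   | yes refl = inj₂ (inj₂ (punchIn-punchOut v≢u ,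
                                  subst (Graph._~_ G v) (sym (punchIn-punchOut v≢a)) (~-sym G ab)))
    ... | no v≢a   | no v≢b   = inj₁ (subst₂ (Graph._~_ G) (sym (punchIn-punchOut v≢a))
                                                     (sym (punchIn-punchOut v≢b)) ab)

  walk : ∀ {x a b} → Star (Within G (λ w → f w ≡ just x)) a b →
         Star (Within (identify G u v) (λ w → f (punchIn v w) ≡ just x)) (ρ a) (ρ b)
  walk ε = ε
  walk {a = a} (_◅_ {j = c} (fa , fc , ac) cb) with ρ a Fin.≟ ρ c
  -- This step of the walk joins `u` and `v` and disappears in the contraction.
  ... | yes eq   = subst (λ i → Star _ i _) (sym eq) (walk cb)
  ... | no ρa≢ρc = (trans (f-ρ a) fa , trans (f-ρ c) fc , ρ-edge ac ρa≢ρc) ◅ walk cb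

  adj : ∀ {x y} → H [ x ~ y ] → ∃₂ λ i j →
        f (punchIn v i) ≡ just x × f (punchIn v j) ≡ just y × identify G u v [ i ~ j ]
  adj {x} {y} xy with Model.adjacent M xy
  -- If the images of `a` and `b` coincided, both would lie in one branch set and `x` would be its
  -- own neighbour in `H`.
  ... | a , b , fa , fb , ab =
    ρ a , ρ b , trans (f-ρ a) fa , trans (f-ρ b) fb , ρ-edge ab λ eq → ~-irrefl H
      (subst (Graph._~_ H x) (just-injective (trans (sym fb) (trans (sym (f-ρ b))
        (trans (cong (f ∘ punchIn v) (sym eq)) (trans (f-ρ a) fa))))) xy)

-- Every step removes a vertex: one outside all branch sets is deleted, and an edge inside a branch
-- set is contracted. When neither exists, the branch sets are single vertices, because a walk
-- inside one cannot take a step.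
model⇒minor : ∀ {k n} {H : Graph k} {G : Graph n} {f} → Model H G f → H IsMinorOf G
model⇒minor {n = zero}  M = bijective-model⇒minor M (λ ()) λ { {()} }
model⇒minor {n = suc n} {G = G} {f} M with any? (λ v → ≡-dec Fin._≟_ (f v) nothing)
... | yes (v , fv) = delete-vertex v (model⇒minor (delete-unused M fv))
... | no ¬unused
  with any? (λ u → any? (λ v → ≡-dec Fin._≟_ (f u) (f v) ×-dec _~?_ G u v))
... | yes (u , v , fuv , uv) = contract-edge uv (model⇒minor (contract-within M fuv uv))
... | no ¬inside = bijective-model⇒minor M total inj
  where
  total : ∀ v → ∃ λ x → f v ≡ just x
  total v with f v in eq
  ... | just x  = x , refl
  ... | nothing = ⊥-elim (¬unused (v , eq))

  inj : ∀ {u v} → f u ≡ f v → u ≡ v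
  inj {u} {v} fuv with total v
  ... | x , fv with Model.connected M x (trans fuv fv) fv
  ... | ε = refl
  ... | (fu , fw , uw) ◅ _ = ⊥-elim (¬inside (_ , _ , trans fu (sym fw) , uw))

-- Components and geodesics

module _ {n} (G : Graph n) where

  within-mono : ∀ {P P′ : Pred (Fin n) 0ℓ} → (∀ {u} → P u → P′ u) →
    ∀ {u v} → Star (Within G P) u v → Star (Within G P′) u v
  within-mono P⊆ = gmap (λ u → u) λ (pu , pv , uv) → P⊆ pu , P⊆ pv , uv

  -- `P′` is `P` together with `v`. The case of an empty `P` serves to start a bag with its first
  -- vertex.
  connectedOn-insert : ∀ {P P′ : Pred (Fin n) 0ℓ} {v} → ConnectedOn G P →
    (∀ {u} → P u → P′ u) → P′ v → (∀ {u} → P′ u → u ≢ v → P u) →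
    (∃ λ w → P w × G [ w ~ v ]) ⊎ (∀ w → ¬ P w) → ConnectedOn G P′
  connectedOn-insert {P} {P′} {v} conn P⊆ P′v only attach {a} {b} pa pb
    with a Fin.≟ v | b Fin.≟ v | attach
  ... | yes refl | yes refl | _ = ε
  ... | yes refl | no b≢v | inj₁ (w , pw , wv) =
    (P′v , P⊆ pw , ~-sym G wv) ◅ within-mono P⊆ (conn pw (only pb b≢v))
  ... | yes refl | no b≢v | inj₂ none = ⊥-elim (none _ (only pb b≢v))
  ... | no a≢v | yes refl | inj₁ (w , pw , wv) =
    within-mono P⊆ (conn (only pa a≢v) pw) ◅◅ (P⊆ pw , P′v , wv) ◅ ε
  ... | no a≢v | yes refl | inj₂ none = ⊥-elim (none _ (only pa a≢v))
  ... | no a≢v | no b≢v | _ = within-mono P⊆ (conn (only pa a≢v) (only pb b≢v))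

record Component {n} (G : Graph n) (P : Pred (Fin n) 0ℓ) (r : Fin n) : Set where
  field
    vertices  : Subset n
    root∈     : r ∈ vertices
    inside    : ∀ {v} → v ∈ vertices → P v
    connected : ConnectedOn G (_∈ vertices)
    closed    : ∀ {u v} → u ∈ vertices → P v → G [ u ~ v ] → v ∈ vertices

module _ {n} (G : Graph n) {P : Pred (Fin n) 0ℓ} (P? : Decidable P) where

  component : ∀ {r} → P r → Component G P r
  component {r} pr = grow n ⁅ r ⁆ (ℕ.m≤m+n n _) (x∈⁅x⁆ r) start-inside start-connected
    where
    start-inside : ∀ {v} → v ∈ ⁅ r ⁆ → P v
    start-inside v∈ with x∈⁅y⁆⇒x≡y r v∈
    ... | refl = pr

    start-connected : ConnectedOn G (_∈ ⁅ r ⁆)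
    start-connected u∈ v∈ with x∈⁅y⁆⇒x≡y r u∈ | x∈⁅y⁆⇒x≡y r v∈
    ... | refl | refl = ε

    -- `fuel` bounds the number of vertices that can still be added to `S`.
    grow : ∀ fuel S → n ≤ fuel + ∣ S ∣ → r ∈ S → (∀ {v} → v ∈ S → P v) →
           ConnectedOn G (_∈ S) → Component G P r
    grow fuel S enough r∈S inside conn
      with any? (λ u → any? (λ v → u ∈? S ×-dec ¬? (v ∈? S) ×-dec P? v ×-dec _~?_ G u v))
    ... | no stuck = record
      { vertices = S ; root∈ = r∈S ; inside = inside ; connected = conn
      ; closed = closed }
      where
      closed : ∀ {u v} → u ∈ S → P v → G [ u ~ v ] → v ∈ S
      closed {u} {v} u∈S pv uv with v ∈? S
      ... | yes v∈S = v∈S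
      ... | no v∉S  = ⊥-elim (stuck (u , v , u∈S , v∉S , pv , uv))
    ... | yes (u , v , u∈S , v∉S , pv , uv) = next fuel enough
      where
      S′ = S ∪ ⁅ v ⁆

      S⊆ : S ⊆ S′
      S⊆ = p⊆p∪q ⁅ v ⁆

      v∈S′ : v ∈ S′
      v∈S′ = x∈p∪q⁺ (inj₂ (x∈⁅x⁆ v))

      larger : ∣ S ∣ < ∣ S′ ∣
      larger = p⊂q⇒∣p∣<∣q∣ (S⊆ , v , v∈S′ , v∉S)

      split : ∀ {w} → w ∈ S′ → w ∈ S ⊎ w ≡ v
      split w∈ with x∈p∪q⁻ S ⁅ v ⁆ w∈
      ... | inj₁ w∈S = inj₁ w∈S
      ... | inj₂ w∈v = inj₂ (x∈⁅y⁆⇒x≡y v w∈v)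

      inside′ : ∀ {w} → w ∈ S′ → P w
      inside′ w∈ with split w∈
      ... | inj₁ w∈S  = inside w∈S
      ... | inj₂ refl = pv

      conn′ : ConnectedOn G (_∈ S′)
      conn′ = connectedOn-insert G conn S⊆ v∈S′
        (λ w∈ w≢v → [ (λ w∈S → w∈S) , (λ w≡v → ⊥-elim (w≢v w≡v)) ] (split w∈))
        (inj₁ (u , u∈S , uv))

      next : ∀ fuel → n ≤ fuel + ∣ S ∣ → Component G P r
      next zero n≤ = ⊥-elim (ℕ.<-irrefl refl (ℕ.≤-trans larger (ℕ.≤-trans (∣p∣≤n S′) n≤)))
      next (suc fuel) n≤ = grow fuel S′
        (ℕ.≤-trans n≤ (ℕ.≤-trans (ℕ.≤-reflexive (sym (ℕ.+-suc fuel _))) (ℕ.+-monoʳ-≤ fuel larger)))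
        (S⊆ {r} r∈S) (λ {w} → inside′ {w}) conn′

-- `dist` stands for the distance from the start of the path and gives the robber's shadow. Off the
-- path, the conditions concern vertices of `R` only, so a path can be kept while the territory
-- shrinks around it.
record ShadowedPath {n} (G : Graph n) (R : Pred (Fin n) 0ℓ) : Set where
  field
    len       : ℕ
    path      : ℕ → Fin n
    dist      : Fin n → ℕ
    path-step : ∀ {k} → k < len → G [ path k ~ path (suc k) ]
    dist-path : ∀ {k} → k ≤ len → dist (path k) ≡ k
    dist-step : ∀ {u v} → R u → R v → G [ u ~ v ] → dist v ≤ suc (dist u)
    dist-near : ∀ {u k} → R u → k ≤ len → G [ u ~ path k ] →
                dist u ≤ suc k × k ≤ suc (dist u)
    parity    : Bipartite G → ∀ {u k} → R u → k ≤ len → G [ u ~ path k ] → dist u ≢ k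

  path-injective : ∀ {i j} → i ≤ len → j ≤ len → path i ≡ path j → i ≡ j
  path-injective i≤ j≤ eq = trans (sym (dist-path i≤)) (trans (cong dist eq) (dist-path j≤))

restrict : ∀ {n} {G : Graph n} {R R′ : Pred (Fin n) 0ℓ} → (∀ {v} → R′ v → R v) →
           ShadowedPath G R → ShadowedPath G R′
restrict R′⊆ P = record
  { len = len ; path = path ; dist = dist ; path-step = path-step ; dist-path = dist-path
  ; dist-step = λ u v → dist-step (R′⊆ u) (R′⊆ v)
  ; dist-near = λ u → dist-near (R′⊆ u)
  ; parity    = λ bip u → parity bip (R′⊆ u) }
  where open ShadowedPath P

-- Geodesics that enter the territory from a vertex outside

module _ {n} (G : Graph n) {R : Pred (Fin n) 0ℓ} (R? : Decidable R)
         (R-connected : ConnectedOn G R) {z u₀} (z∉R : ¬ R z) (u₀∈R : R u₀)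
         (z~u₀ : G [ z ~ u₀ ]) where

  private
    Reach : ℕ → Pred (Fin n) 0ℓ
    Reach zero    v = v ≡ z
    Reach (suc k) v = R v × ∃ λ u → Reach k u × G [ u ~ v ]

    reach? : ∀ k → Decidable (Reach k)
    reach? zero    v = v Fin.≟ z
    reach? (suc k) v = R? v ×-dec any? (λ u → reach? k u ×-dec _~?_ G u v)

    extend : ∀ {u v k} → Reach k u → Star (Within G R) u v → ∃ λ l → Reach l v
    extend ru ε = _ , ru
    extend ru ((_ , rw , uw) ◅ wv) = extend (rw , _ , ru , uw) wv

    nearest : ∀ {v} → R v → ∃ (IsMinimum (λ k → Reach k v))
    nearest {v} v∈R = let k , rv = extend (u₀∈R , z , refl , z~u₀) (R-connected u₀∈R v∈R) in
      minimum (λ k → reach? k v) k rv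

    d : Fin n → ℕ
    d v with R? v
    ... | yes v∈R = proj₁ (nearest v∈R)
    -- The default is correct at `z`, the only vertex outside `R` about which `d-min` speaks.
    ... | no _    = 0

    d-min : ∀ {v} → R v ⊎ v ≡ z → IsMinimum (λ k → Reach k v) (d v)
    d-min {v} v∈ with R? v
    ... | yes v∈R = proj₂ (nearest v∈R)
    ... | no v∉R with v∈
    ...   | inj₁ v∈R  = ⊥-elim (v∉R v∈R)
    ...   | inj₂ refl = refl , λ _ _ → z≤n

    d-z : d z ≡ 0
    d-z = ℕ.n≤0⇒n≡0 (proj₂ (d-min (inj₂ refl)) 0 refl)

    d-lip : ∀ {u v} → R u ⊎ u ≡ z → R v ⊎ v ≡ z → G [ u ~ v ] → d v ≤ suc (d u)
    d-lip u∈ (inj₁ v∈R) uv = proj₂ (d-min (inj₁ v∈R)) _ (v∈R , _ , proj₁ (d-min u∈) , uv)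
    d-lip u∈ (inj₂ refl) uv = ℕ.≤-trans (ℕ.≤-reflexive d-z) z≤n

    side-reach : (bip : Bipartite G) → ∀ k {u v} → Reach k u → Reach k v →
                 proj₁ bip u ≡ proj₁ bip v
    side-reach bip zero refl refl = refl
    side-reach bip (suc k) (_ , u′ , ru , uu) (_ , v′ , rv , vv) =
      trans (¬-not (proj₂ bip _ _ uu ∘ sym))
        (trans (cong not (side-reach bip k ru rv)) (sym (¬-not (proj₂ bip _ _ vv ∘ sym))))

    d-parity : Bipartite G → ∀ {u v} → R u ⊎ u ≡ z → R v ⊎ v ≡ z → G [ u ~ v ] → d u ≢ d v
    d-parity bip {u} {v} u∈ v∈ uv eq = proj₂ bip _ _ uv (side-reach bip (d v)
      (subst (λ k → Reach k u) eq (proj₁ (d-min u∈))) (proj₁ (d-min v∈)))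

    -- The walk contained in a proof of `Reach k v`, indexed by the number of steps and constant
    -- beyond `k`.
    trace : ∀ k {v} → Reach k v → ℕ → Fin n
    trace zero    {v} _ _ = v
    trace (suc k) {v} (_ , u , ru , _) i with i ≤? k
    ... | yes _ = trace k ru i
    ... | no _  = v

    trace-end : ∀ k {v} (rv : Reach k v) → trace k rv k ≡ v
    trace-end zero rv = refl
    trace-end (suc k) rv with suc k ≤? k
    ... | yes k<k = ⊥-elim (ℕ.<-irrefl refl k<k)
    ... | no _    = refl

    trace-start : ∀ k {v} (rv : Reach k v) → trace k rv 0 ≡ z
    trace-start zero refl = refl
    trace-start (suc k) (_ , u , ru , _) = trace-start k ru

    trace-step : ∀ k {v} (rv : Reach k v) {i} → i < k → G [ trace k rv i ~ trace k rv (suc i) ]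
    trace-step (suc k) (_ , u , ru , uv) {i} i<k with i ≤? k | suc i ≤? k
    ... | yes _   | yes i<k′ = trace-step k ru i<k′
    ... | yes i≤k | no i≮k   with ℕ.≤-antisym i≤k (ℕ.≮⇒≥ i≮k)
    ...   | refl = subst (λ w → G [ w ~ _ ]) (sym (trace-end k ru)) uv
    trace-step (suc k) _ i<k | no i≰k | _ = ⊥-elim (i≰k (s≤s⁻¹ i<k))

    trace-reach : ∀ k {v} (rv : Reach k v) {i} → i ≤ k → Reach i (trace k rv i)
    trace-reach zero rv z≤n = rv
    trace-reach (suc k) (rv , u , ru , uv) {i} i≤k with i ≤? k
    ... | yes i≤k′ = trace-reach k ru i≤k′
    ... | no i≰k with ℕ.≤-antisym i≤k (ℕ.≰⇒> i≰k)
    ...   | refl = rv , u , ru , uv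

    reach-in : ∀ k {v} → Reach k v → R v ⊎ v ≡ z
    reach-in zero v≡z = inj₂ v≡z
    reach-in (suc k) (v∈R , _) = inj₁ v∈R

  module _ {q} (q∈R : R q) where

    private
      l : ℕ
      l = d q

      rq : Reach l q
      rq = proj₁ (d-min (inj₁ q∈R))

      p : ℕ → Fin n
      p = trace l rq

      p∈ : ∀ {k} → k ≤ l → R (p k) ⊎ p k ≡ z
      p∈ k≤ = reach-in _ (trace-reach l rq k≤)

      -- Induction from the end `q`, where `d` equals `l`: a step along the walk raises `d` by at
      -- most one, so `d` cannot have fallen behind at `p k`.
      d-p≥ : ∀ j k → j + k ≡ l → k ≤ d (p k)
      d-p≥ zero k refl = ℕ.≤-reflexive (cong d (sym (trace-end l rq)))
      d-p≥ (suc j) k eq = s≤s⁻¹ (ℕ.≤-trans (d-p≥ j (suc k) (trans (ℕ.+-suc j k) eq))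
        (d-lip (p∈ (ℕ.<⇒≤ k<l)) (p∈ k<l) (trace-step l rq k<l)))
        where
        k<l : k < l
        k<l = subst (suc k ≤_) eq (s≤s (ℕ.m≤n+m k j))

      d-p : ∀ {k} → k ≤ l → d (p k) ≡ k
      d-p {k} k≤ = ℕ.≤-antisym (proj₂ (d-min (p∈ k≤)) _ (trace-reach l rq k≤))
                               (d-p≥ (l ∸ k) k (ℕ.m∸n+n≡m k≤))

    geodesic : ShadowedPath G R
    geodesic = record
      { len = l ; path = p ; dist = d ; path-step = trace-step l rq ; dist-path = d-p
      ; dist-step = λ u v → d-lip (inj₁ u) (inj₁ v)
      ; dist-near = λ {u} {k} u∈ k≤ uk →
          subst (λ i → d u ≤ suc i) (d-p k≤) (d-lip (p∈ k≤) (inj₁ u∈) (~-sym G uk)) ,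
          subst (λ i → i ≤ suc (d u)) (d-p k≤) (d-lip (inj₁ u∈) (p∈ k≤) uk)
      ; parity = λ bip u∈ k≤ uk eq → d-parity bip (inj₁ u∈) (p∈ k≤) uk (trans eq (sym (d-p k≤)))
      }

    geodesic-start : ShadowedPath.path geodesic 0 ≡ z
    geodesic-start = trace-start l rq

    geodesic-end : ShadowedPath.path geodesic (ShadowedPath.len geodesic) ≡ q
    geodesic-end = trace-end l rq

    geodesic-inside : ∀ {k} → 0 < k → k ≤ ShadowedPath.len geodesic →
                      R (ShadowedPath.path geodesic k)
    geodesic-inside {suc k} _ k≤ = proj₁ (trace-reach l rq k≤)

-- Guarding a path with one team

data Role : Set where
  behind level ahead : Role

-- The index held by a cop on a path of length `l` when the robber is at distance `d`. Truncated
-- subtraction and the minimum with `l` keep it on the path.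
station : ℕ → Role → ℕ → ℕ
station l behind d = (d ∸ 1) ⊓ l
station l level  d = d ⊓ l
station l ahead  d = suc d ⊓ l

-- The role played while the guard is being set up. The leading cop waits on the shadow, where he
-- and the cop behind bar the robber from path vertices at his own or a smaller distance.
hold : Role → Role
hold ahead = level
hold ρ     = ρ

station≤ : ∀ l ρ d → station l ρ d ≤ l
station≤ l behind d = ℕ.m⊓n≤n (d ∸ 1) l
station≤ l level  d = ℕ.m⊓n≤n d l
station≤ l ahead  d = ℕ.m⊓n≤n (suc d) l

d≤1+[d∸1] : ∀ d → d ≤ suc (d ∸ 1)
d≤1+[d∸1] zero    = z≤n
d≤1+[d∸1] (suc d) = ℕ.≤-refl

pred-lip : ∀ {d d′} → d ≤ suc d′ → d ∸ 1 ≤ suc (d′ ∸ 1)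
pred-lip {d} {d′} d≤ = ℕ.≤-trans (ℕ.∸-monoˡ-≤ 1 d≤) (d≤1+[d∸1] d′)

⊓-lip : ∀ l {a b} → a ≤ suc b → a ⊓ l ≤ suc (b ⊓ l)
⊓-lip l a≤ = ℕ.⊓-mono-≤ a≤ (ℕ.n≤1+n l)

station-lip : ∀ l ρ {d d′} → d ≤ suc d′ → station l ρ d ≤ suc (station l ρ d′)
station-lip l behind d≤ = ⊓-lip l (pred-lip d≤)
station-lip l level  d≤ = ⊓-lip l d≤
station-lip l ahead  d≤ = ⊓-lip l (s≤s d≤)

Close : ℕ → ℕ → Set
Close a b = a ≤ suc b × b ≤ suc a

-- The leading cop must go from the old shadow to one vertex beyond the new one in a single move.
-- This works if the robber does not move away from the start, or if both positions are capped at
-- the end of the path.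
hold-station-close : ∀ l ρ {d d′} → Close d d′ → d′ ≤ d ⊎ l ≤ d →
                     Close (station l (hold ρ) d) (station l ρ d′)
hold-station-close l behind (p , q) _ = station-lip l behind p , station-lip l behind q
hold-station-close l level  (p , q) _ = station-lip l level p , station-lip l level q
hold-station-close l ahead {d} {d′} (p , q) (inj₁ d′≤d) =
  ℕ.≤-trans (ℕ.⊓-monoˡ-≤ l p) (ℕ.n≤1+n _) , ⊓-lip l (s≤s d′≤d)
hold-station-close l ahead {d} {d′} (p , q) (inj₂ l≤d) =
  ℕ.≤-trans (ℕ.⊓-monoˡ-≤ l p) (ℕ.n≤1+n _) ,
  ℕ.≤-trans (ℕ.m⊓n≤n (suc d′) l) (ℕ.≤-trans (ℕ.≤-reflexive (sym (ℕ.m≥n⇒m⊓n≡n l≤d))) (ℕ.n≤1+n _))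

-- Teams of three and of two cops are treated alike. `cover` gives the reason why a robber at
-- distance `k` cannot step onto vertex `k` of the path: a cop is there, or parity forbids it.
record Formation {n} (G : Graph n) (t : ℕ) : Set where
  field
    role      : Fin t → Role
    rear lead : Fin t
    rear-role : role rear ≡ behind
    lead-role : role lead ≡ ahead
    cover     : (∃ λ j → role j ≡ level) ⊎ Bipartite G

module Team {n} (G : Graph n) (conn : Connected G) {t} (F : Formation G t) where
  open Formation F

  Positions : Set
  Positions = Fin t → Fin n

  OccupiedBy : Positions → Pred (Fin n) 0ℓ
  OccupiedBy T v = ∃ λ j → T j ≡ v

  TeamMoves : Rel Positions 0ℓ
  TeamMoves T T′ = ∀ j → Step G (T j) (T′ j)

  stay : ∀ T → TeamMoves T T
  stay T j = inj₁ refl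

  -- One team plays, with the robber to move, until Goal holds; the robber is
  -- confined to R and at no time may he step onto a vertex of W.
  data Play (R W : Pred (Fin n) 0ℓ) (Goal : Positions → Pred (Fin n) 0ℓ) :
            Positions → Pred (Fin n) 0ℓ where
    done     : ∀ {T r} → Goal T r → Play R W Goal T r
    continue : ∀ {T r} →
      (∀ {v} → W v → Step G r v → OccupiedBy T v) →
      (∀ r′ → R r′ → Step G r r′ → ¬ OccupiedBy T r′ →
        ∃ λ T′ → TeamMoves T T′ × Play R W Goal T′ r′) →
      Play R W Goal T r

  _>>=_ : ∀ {R W Goal Goal′ T r} → Play R W Goal T r →
          (∀ {T r} → Goal T r → Play R W Goal′ T r) → Play R W Goal′ T r
  done g >>= f = f g
  continue safe reply >>= f = continue safe λ r′ r′∈R s ¬occ →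
    let T′ , m , p = reply r′ r′∈R s ¬occ in T′ , m , (p >>= f)

  -- Gathering a team on one vertex

  module _ (z : Fin n) where

    data Near : ℕ → Pred (Fin n) 0ℓ where
      here  : ∀ {k} → Near k z
      there : ∀ {k u v} → G [ u ~ v ] → Near k v → Near (suc k) u

    near : ∀ {u} → Star (λ u v → G [ u ~ v ]) u z → ∃ λ k → Near k u
    near ε        = 0 , here
    near (e ◅ es) = let k , nk = near es in suc k , there e nk

    near-mono : ∀ {k k′ u} → k ≤ k′ → Near k u → Near k′ u
    near-mono _        here          = here
    near-mono (s≤s k≤) (there e nk)  = there e (near-mono k≤ nk)

    near-all : ∀ {s} (T : Fin s → Fin n) → ∃ λ k → ∀ j → Near k (T j)
    near-all {zero}  T = 0 , λ ()
    near-all {suc s} T =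
      let k₀ , near₀ = near (conn (T zero) z)
          k₁ , near₁ = near-all (T ∘ suc)
      in k₀ ⊔ k₁ , λ { zero → near-mono (ℕ.m≤m⊔n k₀ k₁) near₀
                     ; (suc j) → near-mono (ℕ.m≤n⊔m k₀ k₁) (near₁ j) }

    advance : ∀ {k u} → Near (suc k) u →
              ∃ λ u′ → Step G u u′ × Near k u′ × (u ≡ z → u′ ≡ z)
    advance {u = u} nk with u Fin.≟ z
    ... | yes refl = z , inj₁ refl , here , id
    advance here         | no u≢z = ⊥-elim (u≢z refl)
    advance (there e nk) | no u≢z = _ , inj₂ e , nk , ⊥-elim ∘ u≢z

    -- If `z` has to be guarded meanwhile, a cop is there already, and `advance` never moves a cop
    -- away from `z`.
    gather : ∀ {R W T r} → (∀ {v} → W v → v ≡ z × OccupiedBy T z) →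
             Play R W (λ T r → (∀ j → T j ≡ z) × r ≢ z) T r
    gather {R} {W} {T} {r} hyp = go (proj₁ (near-all T)) (proj₂ (near-all T)) hyp
      where
      safe : ∀ {T r} → (∀ {v} → W v → v ≡ z × OccupiedBy T z) →
             ∀ {v} → W v → Step G r v → OccupiedBy T v
      safe hyp w _ with hyp w
      ... | refl , occ = occ

      go : ∀ k {T r} → (∀ j → Near k (T j)) → (∀ {v} → W v → v ≡ z × OccupiedBy T z) →
           Play R W (λ T r → (∀ j → T j ≡ z) × r ≢ z) T r
      -- One more move of the robber is awaited: he may be on `z` when the cops arrive there, and
      -- then has to leave it.
      go zero {T} near hyp = continue (safe hyp) λ r′ _ _ ¬occ →
        T , stay T , done (at-z , λ r′≡z → ¬occ (rear , trans (at-z rear) (sym r′≡z)))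
        where
        at-z : ∀ j → T j ≡ z
        at-z j with T j | near j
        ... | _ | here = refl
      go (suc k) {T} near hyp = continue (safe hyp) λ r′ _ _ _ →
        proj₁ ∘ next , proj₁ ∘ proj₂ ∘ next ,
        go k (proj₁ ∘ proj₂ ∘ proj₂ ∘ next) λ w →
          let v≡z , j , Tj = hyp w in v≡z , j , proj₂ (proj₂ (proj₂ (next j))) Tj
        where
        next : ∀ j → _
        next j = advance (near j)

  -- Shadowing the robber along a path

  module OnPath {R : Pred (Fin n) 0ℓ} (P : ShadowedPath G R) where
    open ShadowedPath P

    OnStation : Positions → Pred (Fin n) 0ℓ
    OnStation T r = ∀ j → T j ≡ path (station len (role j) (dist r))

    OffPath : Pred (Fin n) 0ℓ
    OffPath r = ∀ {k} → k ≤ len → r ≢ path k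

    path-close : ∀ {a b} → Close a b → a ≤ len → b ≤ len → Step G (path a) (path b)
    path-close {a} {b} (a≤ , b≤) a≤l b≤l with ℕ.<-cmp a b
    ... | tri≈ _ refl _ = inj₁ refl
    ... | tri< a<b _ _ with ℕ.≤-antisym b≤ a<b
    ...   | refl = inj₂ (path-step b≤l)
    path-close {a} {b} (a≤ , b≤) a≤l b≤l | tri> _ _ b<a with ℕ.≤-antisym a≤ b<a
    ...   | refl = inj₂ (~-sym G (path-step a≤l))

    dist-close : ∀ {r r′} → R r → R r′ → Step G r r′ → Close (dist r) (dist r′)
    dist-close _ _ (inj₁ refl) = ℕ.n≤1+n _ , ℕ.n≤1+n _
    dist-close r∈ r′∈ (inj₂ e) = dist-step r′∈ r∈ (~-sym G e) , dist-step r∈ r′∈ e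

    station-close : ∀ ρ {r r′} → R r → R r′ → Step G r r′ →
                    Close (station len ρ (dist r)) (station len ρ (dist r′))
    station-close ρ r∈ r′∈ s = let p , q = dist-close r∈ r′∈ s in
      station-lip len ρ p , station-lip len ρ q

    on-station-follows : ∀ {T r r′} → R r → R r′ → Step G r r′ → OnStation T r →
                         ∃ λ T′ → TeamMoves T T′ × OnStation T′ r′
    on-station-follows r∈ r′∈ s on = _ , (λ j → subst (λ v → Step G v _) (sym (on j))
        (path-close (station-close (role j) r∈ r′∈ s) (station≤ len (role j) _)
                    (station≤ len (role j) _))) , λ j → refl

    rear-at : ∀ {T r k} → OnStation T r → k ≤ len → dist r ≡ suc k → T rear ≡ path k
    rear-at {T} {r} {k} on k≤ eq = trans (on rear) (cong path
      (trans (cong₂ (station len) rear-role eq) (ℕ.m≤n⇒m⊓n≡m k≤)))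

    -- By `dist-near` the distance of `r` differs from `k` by at most one. If it is smaller the
    -- leading cop is on `path k`, if larger the rear cop; if equal, a level cop is there or the
    -- graph is bipartite and there is no such edge.
    on-station-guards : ∀ {T r k} → R r → OffPath r → OnStation T r → k ≤ len →
                        Step G r (path k) → OccupiedBy T (path k)
    on-station-guards r∈ off on k≤ (inj₁ eq) = ⊥-elim (off k≤ eq)
    on-station-guards {T} {r} {k} r∈ off on k≤ (inj₂ e)
      with ℕ.<-cmp (dist r) k | dist-near r∈ k≤ e
    ... | tri< d<k _ _ | _ , k≤1+d = lead , trans (on lead) (cong path
      (trans (cong (λ ρ → station len ρ (dist r)) lead-role)
        (trans (cong (_⊓ len) (ℕ.≤-antisym d<k k≤1+d)) (ℕ.m≤n⇒m⊓n≡m k≤))))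
    ... | tri> _ _ k<d | d≤1+k , _ = rear , rear-at {T} {r} on k≤ (ℕ.≤-antisym d≤1+k k<d)
    ... | tri≈ _ d≡k _ | _ with cover
    ...   | inj₁ (j , j-level) = j , trans (on j) (cong path
      (trans (cong₂ (station len) j-level d≡k) (ℕ.m≤n⇒m⊓n≡m k≤)))
    ...   | inj₂ bip = ⊥-elim (parity bip r∈ k≤ e d≡k)

    module _ {W : Pred (Fin n) 0ℓ} (W⊆ : ∀ {v} → W v → v ≡ path 0) (start∉R : ¬ R (path 0)) where

      private
        Guarding : Positions → Pred (Fin n) 0ℓ
        Guarding T r = OnStation T r × OffPath r

        approach : Fin t → Fin n → ℕ
        approach j r = station len (hold (role j)) (dist r)

        approach≤ : ∀ j r → approach j r ≤ len
        approach≤ j r = station≤ len (hold (role j)) (dist r)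

        approach-close : ∀ j {r r′} → R r → R r′ → Step G r r′ →
                         Close (approach j r) (approach j r′)
        approach-close j = station-close (hold (role j))

        approach-rear : ∀ r → approach rear r ≡ (dist r ∸ 1) ⊓ len
        approach-rear r = cong (λ ρ → station len (hold ρ) (dist r)) rear-role

        approach-lead : ∀ r → approach lead r ≡ dist r ⊓ len
        approach-lead r = cong (λ ρ → station len (hold ρ) (dist r)) lead-role

        -- Next to `path 0` the robber is at distance at most one, so the rear cop aims at index 0.
        -- As he never overshoots his aim, he is on `path 0` then.
        safe : ∀ {T r c} → R r → T rear ≡ path c → c ≤ approach rear r →
               ∀ {v} → W v → Step G r v → OccupiedBy T v
        safe {T} {r} {c} r∈ at c≤ w s with W⊆ w
        safe {T} {r} {c} r∈ at c≤ w (inj₁ refl) | refl = ⊥-elim (start∉R r∈)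
        safe {T} {r} {c} r∈ at c≤ w (inj₂ e)    | refl = rear , trans at (cong path c≡0)
          where
          c≡0 : c ≡ 0
          c≡0 = ℕ.n≤0⇒n≡0 (ℕ.≤-trans c≤ (ℕ.≤-trans (ℕ.≤-reflexive (approach-rear r))
            (ℕ.≤-trans (ℕ.m⊓n≤m (dist r ∸ 1) len)
                       (ℕ.∸-monoˡ-≤ 1 (proj₁ (dist-near r∈ z≤n e))))))

        Approached : Positions → Pred (Fin n) 0ℓ
        Approached T r = ∀ j → T j ≡ path (approach j r)

        -- The cops behind and level with the robber's shadow force him away
        -- from the start of the path for as long as he delays the leading
        -- cop's step ahead, so len ∸ dist r decreases.
        settle : ∀ fuel {T r} → len ≤ fuel + dist r → R r → Approached T r →
                 Play R W Guarding T r
        settle fuel {T} {r} enough r∈ at =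
          continue (safe r∈ (at rear) ℕ.≤-refl) reply
          where
          take : ∀ {r′} → R r′ → Step G r r′ → dist r′ ≤ dist r ⊎ len ≤ dist r → OffPath r′ →
                 ∃ λ T′ → TeamMoves T T′ × Play R W Guarding T′ r′
          take {r′} r′∈ s small off = (λ j → path (station len (role j) (dist r′))) ,
            (λ j → subst (λ v → Step G v _) (sym (at j)) (path-close
              (hold-station-close len (role j) (dist-close r∈ r′∈ s) small)
              (approach≤ j r) (station≤ len (role j) _))) ,
            done ((λ j → refl) , off)

          off-path : ∀ {r′} → R r′ → Step G r r′ → dist r′ ≤ dist r → ¬ OccupiedBy T r′ → OffPath r′
          off-path r′∈ s d′≤d ¬occ {k} k≤ refl with ℕ.m≤n⇒m<n∨m≡n d′≤d
          ... | inj₂ d′≡d = ¬occ (lead , trans (at lead) (cong path (trans (approach-lead r)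
            (trans (cong (_⊓ len) (trans (sym d′≡d) (dist-path k≤))) (ℕ.m≤n⇒m⊓n≡m k≤)))))
          ... | inj₁ d′<d = ¬occ (rear , trans (at rear) (cong path (trans (approach-rear r)
            (trans (cong (λ d → (d ∸ 1) ⊓ len) d≡) (ℕ.m≤n⇒m⊓n≡m k≤)))))
            where
            d≡ : dist r ≡ suc k
            d≡ = trans (ℕ.≤-antisym (proj₁ (dist-close r∈ r′∈ s)) d′<d) (cong suc (dist-path k≤))

          reply : ∀ r′ → R r′ → Step G r r′ → ¬ OccupiedBy T r′ →
                  ∃ λ T′ → TeamMoves T T′ × Play R W Guarding T′ r′
          reply r′ r′∈ s ¬occ with dist r′ ≤? dist r
          ... | yes d′≤d = take r′∈ s (inj₁ d′≤d) (off-path r′∈ s d′≤d ¬occ)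
          ... | no d′≰d = farther fuel enough
            where
            farther : ∀ fuel → len ≤ fuel + dist r →
                      ∃ λ T′ → TeamMoves T T′ × Play R W Guarding T′ r′
            -- The robber is now farther from the start than the end of the path, where the leading
            -- cop already waits.
            farther zero len≤d = take r′∈ s (inj₂ len≤d) λ { k≤ refl →
              d′≰d (ℕ.≤-trans (ℕ.≤-trans (ℕ.≤-reflexive (dist-path k≤)) k≤) len≤d) }
            farther (suc fuel) len≤ = (λ j → path (approach j r′)) ,
              (λ j → subst (λ v → Step G v _) (sym (at j))
                (path-close (approach-close j r∈ r′∈ s) (approach≤ j r) (approach≤ j r′))) ,
              settle fuel (ℕ.≤-trans len≤ (ℕ.≤-trans (ℕ.≤-reflexive (sym (ℕ.+-suc fuel _)))
                (ℕ.+-monoʳ-≤ fuel (ℕ.≰⇒> d′≰d)))) r′∈ (λ j → refl)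

        -- The cops run up the path from `path 0` and never overtake the indices they aim at, as
        -- `safe` requires of the rear cop. `k` measures the progress of those that have not caught
        -- up.
        Chasing : ℕ → Positions → Pred (Fin n) 0ℓ
        Chasing k T r = ∀ j → ∃ λ c → T j ≡ path c × c ≤ approach j r × (c ≡ approach j r ⊎ k ≤ c)

        pursue : ∀ {k c a a′} → c ≤ a → c ≡ a ⊎ k ≤ c → Close a a′ →
                 ∃ λ c′ → Close c c′ × c′ ≤ a′ × (c′ ≡ a′ ⊎ suc k ≤ c′)
        pursue {c = c} {a} {a′} c≤a caught (a≤ , a′≤) with ℕ.<-cmp c a′ | caught
        ... | tri≈ _ refl _ | _ = c , (ℕ.n≤1+n c , ℕ.n≤1+n c) , ℕ.≤-refl , inj₁ refl
        ... | tri> _ _ a′<c | _ = a′ , (ℕ.≤-trans c≤a a≤ , ℕ.≤-trans (ℕ.<⇒≤ a′<c) (ℕ.n≤1+n c)) ,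
                                  ℕ.≤-refl , inj₁ refl
        ... | tri< c<a′ _ _ | inj₁ refl = a′ , (a≤ , a′≤) , ℕ.≤-refl , inj₁ refl
        ... | tri< c<a′ _ _ | inj₂ k≤c = suc c ,
          (ℕ.≤-trans (ℕ.n≤1+n c) (ℕ.n≤1+n _) , ℕ.≤-refl) , c<a′ , inj₂ (s≤s k≤c)

        -- Cops not yet in place gain one vertex per round. Once `k` reaches `len` all are where
        -- `settle` needs them, since no aim exceeds `len`.
        chase : ∀ fuel {k T r} → len ≤ fuel + k → R r → Chasing k T r → Play R W Guarding T r
        chase zero {k} {T} {r} len≤k r∈ ch = settle len (ℕ.m≤m+n len _) r∈ at
          where
          at : Approached T r
          at j with ch j
          ... | c , Tj , c≤ , inj₁ refl = Tj
          ... | c , Tj , c≤ , inj₂ k≤c = trans Tj (cong path (ℕ.≤-antisym c≤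
            (ℕ.≤-trans (approach≤ j r) (ℕ.≤-trans len≤k k≤c))))
        chase (suc fuel) {k} {T} {r} len≤ r∈ ch =
          let c , at , c≤ , _ = ch rear in
          continue (safe r∈ at c≤) λ r′ r′∈ s _ → reply r′ r′∈ s
          where
          reply : ∀ r′ → R r′ → Step G r r′ → ∃ λ T′ → TeamMoves T T′ × Play R W Guarding T′ r′
          reply r′ r′∈ s = (λ j → path (proj₁ (next j))) ,
            (λ j → let c , Tj , c≤ , _ = ch j
                       c′ , close , c′≤ , _ = next j in
              subst (λ v → Step G v _) (sym Tj) (path-close close
                (ℕ.≤-trans c≤ (approach≤ j r)) (ℕ.≤-trans c′≤ (approach≤ j r′)))) ,
            chase fuel (ℕ.≤-trans len≤ (ℕ.≤-reflexive (sym (ℕ.+-suc fuel k)))) r′∈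
              (λ j → let c′ , _ , c′≤ , caught = next j in c′ , refl , c′≤ , caught)
            where
            next : ∀ j → _
            next j = let c , Tj , c≤ , caught = ch j in
              pursue {k} c≤ caught (approach-close j r∈ r′∈ s)

      extend-guard : ∀ {T r} → R r → (∀ j → T j ≡ path 0) →
                     Play R W (λ T r → OnStation T r × OffPath r) T r
      extend-guard r∈ at = chase len (ℕ.m≤m+n len 0) r∈ λ j → 0 , at j , z≤n , inj₂ z≤n

    -- Giving up a path for one of its vertices

    module _ (disjoint : ∀ {k} → k ≤ len → ¬ R (path k)) {i} (i≤ : i ≤ len) where

      private
        Reached : Positions → Pred (Fin n) 0ℓ
        Reached T r = OccupiedBy T (path i)

        S : Fin t → Fin n → ℕ
        S j r = station len (role j) (dist r)

        S-rear : ∀ r → S rear r ≡ (dist r ∸ 1) ⊓ len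
        S-rear r = cong (λ ρ → station len ρ (dist r)) rear-role

        S-lead : ∀ r → S lead r ≡ suc (dist r) ⊓ len
        S-lead r = cong (λ ρ → station len ρ (dist r)) lead-role

        off : ∀ {r} → R r → OffPath r
        off r∈ k≤ refl = disjoint k≤ r∈

        send : ∀ (T : Positions) j {a b} → T j ≡ path a → Close a b → a ≤ len → b ≤ len →
               TeamMoves T (updateAt T j (const (path b)))
        send T j Tj close a≤ b≤ j′ with j′ Fin.≟ j
        ... | yes refl = subst₂ (Step G) (sym Tj) (sym (updateAt-updates j T)) (path-close close a≤ b≤)
        ... | no j′≢j  = inj₁ (sym (updateAt-minimal j′ j T j′≢j))

        near-i : ∀ {r} → R r → Step G r (path i) → dist r ≤ suc i × i ≤ suc (dist r)
        near-i r∈ (inj₁ eq) = ⊥-elim (off r∈ i≤ eq)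
        near-i r∈ (inj₂ e)  = dist-near r∈ i≤ e

        -- The rear cop walks down to `i` while his proper station, which changes by at most one per
        -- round, stays at or above him. Until he arrives the robber is at distance more than
        -- `suc i`, too far to step onto `path i`.
        run-back : ∀ f {T r} → R r → T rear ≡ path (f + i) → f + i ≤ S rear r →
                   Play R (_≡ path i) Reached T r
        run-back zero r∈ at _ = done (rear , at)
        run-back (suc f) {T} {r} r∈ at ≤S = continue
          (λ { refl s → ⊥-elim (ℕ.<-irrefl refl (ℕ.≤-trans (s≤s (ℕ.m≤n+m i f))
            (ℕ.≤-trans ≤S (ℕ.≤-trans (ℕ.≤-reflexive (S-rear r)) (ℕ.≤-trans
              (ℕ.m⊓n≤m (dist r ∸ 1) len) (ℕ.∸-monoˡ-≤ 1 (proj₁ (near-i r∈ s)))))))) })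
          λ r′ r′∈ s _ → _ ,
            send T rear at (ℕ.≤-refl , ℕ.≤-trans (ℕ.n≤1+n _) (ℕ.n≤1+n _)) c≤ (ℕ.<⇒≤ c≤) ,
            run-back f r′∈ (updateAt-updates rear T)
              (s≤s⁻¹ (ℕ.≤-trans ≤S (proj₁ (station-close (role rear) r∈ r′∈ s))))
          where
          c≤ : suc f + i ≤ len
          c≤ = ℕ.≤-trans ≤S (station≤ len (role rear) (dist r))

        -- The mirror image with the leading cop, whose proper station stays at or below him: until
        -- he arrives, the robber is too close to the start to step onto `path i`.
        run-ahead : ∀ f {c T r} → f + c ≡ i → R r → T lead ≡ path c → S lead r ≤ c →
                    Play R (_≡ path i) Reached T r
        run-ahead zero refl r∈ at _ = done (lead , at)
        run-ahead (suc f) {c} {T} {r} eq r∈ at S≤ = continue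
          (λ { refl s → ⊥-elim (ℕ.<-irrefl refl (ℕ.≤-trans c<i (ℕ.≤-trans
            (ℕ.⊓-glb (proj₂ (near-i r∈ s)) i≤) (ℕ.≤-trans (ℕ.≤-reflexive (sym (S-lead r))) S≤)))) })
          λ r′ r′∈ s _ → _ ,
            send T lead at (ℕ.≤-trans (ℕ.n≤1+n _) (ℕ.n≤1+n _) , ℕ.≤-refl)
              (ℕ.<⇒≤ (ℕ.≤-trans c<i i≤)) (ℕ.≤-trans c<i i≤) ,
            run-ahead f (trans (ℕ.+-suc f c) eq) r′∈ (updateAt-updates lead T)
              (ℕ.≤-trans (proj₂ (station-close (role lead) r∈ r′∈ s)) (s≤s S≤))
          where
          c<i : c < i
          c<i = subst (suc c ≤_) eq (s≤s (ℕ.m≤n+m c f))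

        reach : ∀ {T r} → R r → OnStation T r → Play R (_≡ path i) Reached T r
        reach {T} {r} r∈ on with i ≤? S rear r | S lead r ≤? i
        ... | yes i≤S | _ = run-back (S rear r ∸ i) r∈
          (trans (on rear) (cong path (sym (ℕ.m∸n+n≡m i≤S)))) (ℕ.≤-reflexive (ℕ.m∸n+n≡m i≤S))
        ... | no _ | yes S≤i = run-ahead (i ∸ S lead r) (ℕ.m∸n+n≡m S≤i) r∈ (on lead) ℕ.≤-refl
        -- Strictly between the two stations, `i` can only be `dist r`. The guard still holds for
        -- the robber's next move, and then the rear cop, one step away, enters `path i`.
        ... | no i≰S | no S≰i = continue (λ { refl → on-station-guards r∈ (off r∈) on i≤ })
          λ r′ r′∈ s _ → _ ,
            send T rear (on rear) close (station≤ len (role rear) (dist r)) i≤ ,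
            done (rear , updateAt-updates rear T)
          where
          close : Close (S rear r) i
          close = ℕ.≤-trans (ℕ.<⇒≤ (ℕ.≰⇒> i≰S)) (ℕ.n≤1+n i) ,
            ℕ.≤-trans (ℕ.⊓-glb (ℕ.≤-trans i≤d (d≤1+[d∸1] (dist r))) (ℕ.≤-trans i≤ (ℕ.n≤1+n len)))
              (s≤s (ℕ.≤-reflexive (sym (S-rear r))))
            where
            i≤d : i ≤ dist r
            i≤d = s≤s⁻¹ (ℕ.≤-trans (ℕ.≰⇒> S≰i) (ℕ.≤-trans (ℕ.≤-reflexive (S-lead r)) (ℕ.m⊓n≤m _ len)))

      collapse : ∀ {T r} → R r → OnStation T r →
                 Play R (_≡ path i) (λ T r → (∀ j → T j ≡ path i) × r ≢ path i) T r
      collapse r∈ on = reach r∈ on >>= λ occ → gather (path i) λ w → w , occ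

-- The joint strategy of the teams

total : ∀ {m} → (Fin m → ℕ) → ℕ
total {zero}  f = 0
total {suc m} f = f zero + total (f ∘ suc)

total-decreases : ∀ {m} {f g : Fin m → ℕ} e → f e < g e → (∀ e′ → e′ ≢ e → f e′ ≡ g e′) →
                  total f < total g
total-decreases {suc m} {f} {g} zero f<g same =
  ℕ.+-mono-<-≤ f<g (ℕ.≤-reflexive (total-cong λ e → same (suc e) λ ()))
  where
  total-cong : ∀ {m} {f g : Fin m → ℕ} → (∀ e → f e ≡ g e) → total f ≡ total g
  total-cong {zero}  eq = refl
  total-cong {suc m} eq = cong₂ _+_ (eq zero) (total-cong (eq ∘ suc))
total-decreases {suc m} {f} {g} (suc e) f<g same =
  ℕ.+-mono-≤-< (ℕ.≤-reflexive (same zero λ ()))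
    (total-decreases e f<g λ e′ e′≢e → same (suc e′) λ { refl → e′≢e refl })

updateAt-elim : ∀ {a} {A : Set a} {m} (Q : Fin m → A → Set) (f : Fin m → A) {e x} →
  Q e x → (∀ {e′} → e′ ≢ e → Q e′ (f e′)) → ∀ e′ → Q e′ (updateAt f e (const x) e′)
updateAt-elim Q f {e} {x} new old e′ with e′ Fin.≟ e
... | yes refl = subst (Q e) (sym (updateAt-updates e f)) new
... | no e′≢e  = subst (Q e′) (sym (updateAt-minimal e′ e f e′≢e)) (old e′≢e)

module Strategy {n} (G : Graph n) (conn : Connected G) {t} (F : Formation G t)
                {k m} (ends : Fin m → Fin k × Fin k)
                (loopless : ∀ e → proj₁ (ends e) ≢ proj₂ (ends e)) where
  open Team G conn F
  open Formation F using (rear)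

  -- Labels, duties and states

  Ends : Fin m → Fin k → Fin k → Set
  Ends e a b = ends e ≡ (a , b) ⊎ ends e ≡ (b , a)

  ends-distinct : ∀ {e a b} → Ends e a b → a ≢ b
  ends-distinct {e} (inj₁ eq) refl = loopless e (trans (cong proj₁ eq) (cong proj₂ (sym eq)))
  ends-distinct {e} (inj₂ eq) refl = loopless e (trans (cong proj₁ eq) (cong proj₂ (sym eq)))

  -- One label per vertex makes bags and path interiors disjoint without further conditions.
  -- `inner e` reserves a vertex for the path of the edge `e`.
  data Label : Set where
    none  : Label
    bag   : Fin k → Label
    inner : Fin m → Label

  bag-injective : ∀ {x y} → bag x ≡ bag y → x ≡ y
  bag-injective refl = refl

  bag? : ∀ l x → Dec (l ≡ bag x)
  bag? none x = no λ ()
  bag? (inner _) x = no λ ()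
  bag? (bag y) x with y Fin.≟ x
  ... | yes refl = yes refl
  ... | no y≢x   = no λ { refl → y≢x refl }

  Labelling : Set
  Labelling = Fin n → Label

  -- With `thick P i j` the team shadows the robber along all of `P`, but only the stretch from `i`
  -- to `j` is relied on as a guard.
  data Duty (R : Subset n) : Set where
    free  : Duty R
    thin  : Fin n → Duty R
    thick : ShadowedPath G (_∈ R) → (i j : ℕ) → Duty R

  module _ {R : Subset n} where
    open ShadowedPath

    Guards : Duty R → Pred (Fin n) 0ℓ
    Guards free          v = ⊥
    Guards (thin z)      v = v ≡ z
    Guards (thick P i j) v = ∃ λ c → i ≤ c × c ≤ j × v ≡ path P c

    Keeps : Duty R → Positions → Pred (Fin n) 0ℓ
    Keeps free          T r = ⊤
    Keeps (thin z)      T r = ∀ j → T j ≡ z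
    Keeps (thick P i j) T r = OnPath.OnStation P T r

    record ThinAt (lab : Labelling) (e : Fin m) (z : Fin n) : Set where
      constructor thin-at
      field
        {home away} : Fin k
        ends-of    : Ends e home away
        home-bag   : lab z ≡ bag home

    record ThickAt (lab : Labelling) (e : Fin m) (P : ShadowedPath G (_∈ R)) (i j : ℕ) : Set where
      constructor thick-at
      field
        i<j       : i < j
        j≤len     : j ≤ len P
        disjoint  : ∀ {c} → c ≤ len P → path P c ∉ R
        {left right} : Fin k
        ends-of   : Ends e left right
        left-bag  : lab (path P i) ≡ bag left
        right-bag : lab (path P j) ≡ bag right
        interior  : ∀ {c} → i < c → c < j → lab (path P c) ≡ inner e

    Valid : Labelling → Fin m → Duty R → Set
    Valid lab e free          = ⊤
    Valid lab e (thin z)      = ThinAt lab e z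
    Valid lab e (thick P i j) = ThickAt lab e P i j

    valid-mono : ∀ {lab lab′ e} s → (∀ {v x} → lab v ≡ bag x → lab′ v ≡ bag x) →
      (∀ {v} → lab v ≡ inner e → lab′ v ≡ inner e) → Valid lab e s → Valid lab′ e s
    valid-mono free          b i v = tt
    valid-mono (thin z)      b i (thin-at es nb) = thin-at es (b nb)
    valid-mono (thick P _ _) b i (thick-at i<j j≤ dis es lb rb int) =
      thick-at i<j j≤ dis es (b lb) (b rb) λ i<c c<j → i (int i<c c<j)

    Adjacent : Pred (Fin n) 0ℓ
    Adjacent v = ∃ λ u → u ∈ R × G [ v ~ u ]

    adjacent? : Decidable Adjacent
    adjacent? v = any? λ u → u ∈? R ×-dec _~?_ G v u

    Normal : Duty R → Set
    Normal free          = ⊤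
    Normal (thin z)      = Adjacent z
    Normal (thick P i j) = Adjacent (path P i) × Adjacent (path P j)

    normal? : Decidable Normal
    normal? free          = yes tt
    normal? (thin z)      = adjacent? z
    normal? (thick P i j) = adjacent? (path P i) ×-dec adjacent? (path P j)

    -- The number of guarded vertices, which falls when a duty is trimmed and `R` stays the same.
    size : Duty R → ℕ
    size free          = 0
    size (thin z)      = 1
    size (thick P i j) = suc (j ∸ i)

    follows : ∀ {lab e T r r′} s → Valid lab e s → r ∈ R → r′ ∈ R → Step G r r′ → Keeps s T r →
              ∃ λ T′ → TeamMoves T T′ × Keeps s T′ r′
    follows {T = T} free     _ _ _ _ _  = T , stay T , tt
    follows {T = T} (thin z) _ _ _ _ at = T , stay T , at
    follows {T = T} {r} (thick P i j) _ r∈ r′∈ s on =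
      OnPath.on-station-follows P {T} {r} r∈ r′∈ s on

    guards-occupied : ∀ {lab e T r v} s → Valid lab e s → r ∈ R → Keeps s T r → Guards s v →
                      Step G r v → OccupiedBy T v
    guards-occupied (thin z) _ _ at refl _ = rear , at rear
    guards-occupied {T = T} {r} (thick P i j) va r∈ on (c , i≤c , c≤j , refl) s =
      OnPath.on-station-guards P {T} {r} r∈
        (λ { c≤ refl → ThickAt.disjoint va c≤ r∈ }) on (ℕ.≤-trans c≤j (ThickAt.j≤len va)) s

  module _ {R R′ : Subset n} (R′⊆ : ∀ {v} → v ∈ R′ → v ∈ R) where

    restrictDuty : Duty R → Duty R′
    restrictDuty free          = free
    restrictDuty (thin z)      = thin z
    restrictDuty (thick P i j) = thick (restrict R′⊆ P) i j

    restrict-valid : ∀ {lab e} s → Valid lab e s → Valid lab e (restrictDuty s)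
    restrict-valid free          _ = tt
    restrict-valid (thin z)      (thin-at es nb) = thin-at es nb
    restrict-valid (thick P i j) (thick-at i<j j≤ dis es lb rb int) =
      thick-at i<j j≤ (λ c≤ → dis c≤ ∘ R′⊆) es lb rb int

    restrict-keeps : ∀ {T r} s → Keeps s T r → Keeps (restrictDuty s) T r
    restrict-keeps free          _  = tt
    restrict-keeps (thin z)      at = at
    restrict-keeps (thick P i j) on = on

    restrict-guards : ∀ {v} s → Guards s v → Guards (restrictDuty s) v
    restrict-guards (thin z)      g = g
    restrict-guards (thick P i j) g = g

    restrict-size : ∀ s → size (restrictDuty s) ≡ size s
    restrict-size free          = refl
    restrict-size (thin z)      = refl
    restrict-size (thick P i j) = refl

  -- A state fixes the territory and the tasks of the teams, not where robber and cops are. Bags may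
  -- be empty, their connectedness being vacuous.
  record State : Set where
    field
      R           : Subset n
      R-connected : ConnectedOn G (_∈ R)
      lab         : Labelling
      unlabelled  : ∀ {v} → v ∈ R → lab v ≡ none
      bags        : ∀ x → ConnectedOn G (λ v → lab v ≡ bag x)
      duty        : Fin m → Duty R
      valid       : ∀ e → Valid lab e (duty e)
      boundary    : ∀ {u v} → u ∈ R → v ∉ R → G [ u ~ v ] → ∃ λ e → Guards (duty e) v

    labelled⇒∉R : ∀ {v x} → lab v ≡ bag x → v ∉ R
    labelled⇒∉R eq v∈ with trans (sym eq) (unlabelled v∈)
    ... | ()

  open State

  measure : State → ℕ × ℕ
  measure S = ∣ R S ∣ , total (size ∘ duty S)

  _≺_ : Rel State 0ℓ
  S′ ≺ S = ×-Lex _≡_ _<_ _<_ (measure S′) (measure S)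

  ≺-wellFounded : WellFounded _≺_
  ≺-wellFounded = On.wellFounded measure (×-wellFounded <-wellFounded <-wellFounded)

  -- Playing the game with all teams

  copAt : (Fin m → Positions) → Fin (t * m) → Fin n
  copAt T i = let (j , e) = remQuot {t} m i in T e j

  placement : (Fin m → Positions) → Vec (Fin n) (t * m)
  placement T = tabulate (copAt T)

  lookup-placement : ∀ T e j → lookup (placement T) (combine j e) ≡ T e j
  lookup-placement T e j = trans (lookup∘tabulate (copAt T) (combine j e))
    (cong (λ (j , e) → T e j) (remQuot-combine j e))

  placement-occupied : ∀ {T e v} → OccupiedBy (T e) v → Occupied G (placement T) v
  placement-occupied {T} {e} (j , eq) = combine j e , trans (lookup-placement T e j) eq

  placement-moves : ∀ {T T′} → (∀ e → TeamMoves (T e) (T′ e)) → Moves G (placement T) (placement T′)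
  placement-moves {T} {T′} ms i =
    subst₂ (Step G) (sym (lookup∘tabulate (copAt T) i)) (sym (lookup∘tabulate (copAt T′) i))
      (let (j , e) = remQuot {t} m i in ms e j)

  RobberLoses : (Fin m → Positions) → Pred (Fin n) 0ℓ
  RobberLoses T r = CopsWin G robber (placement T) r

  Good : State → Set
  Good S = ∀ {T r} → r ∈ R S → (∀ e → Keeps (duty S e) (T e) r) → RobberLoses T r

  module _ (S : State) (e : Fin m) where

    OthersKeep : (Fin m → Positions) → Pred (Fin n) 0ℓ
    OthersKeep T r = ∀ {e′} → e′ ≢ e → Keeps (duty S e′) (T e′) r

    OtherGuards : Pred (Fin n) 0ℓ
    OtherGuards v = ∃ λ e′ → e′ ≢ e × Guards (duty S e′) v

    module _ {W : Pred (Fin n) 0ℓ}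
             (border : ∀ {u v} → u ∈ R S → v ∉ R S → G [ u ~ v ] → W v ⊎ OtherGuards v) where

      -- Team `e` follows its own play while the others answer each move by keeping their duties.
      -- The robber cannot leave `R`: a neighbour outside is in `W`, occupied by team `e` whenever
      -- he can step there, or is guarded by another team.
      playout : ∀ {Goal Tₑ T r} → r ∈ R S → OthersKeep T r → T e ≡ Tₑ →
        Play (_∈ R S) W Goal Tₑ r →
        (∀ {T r} → r ∈ R S → OthersKeep T r → Goal (T e) r → RobberLoses T r) →
        RobberLoses T r
      playout r∈ others refl (done goal) win = win r∈ others goal
      playout {Goal} {T = T} {r} r∈ others refl (continue safe reply) win = robber-moves λ r′ (s , ¬occ) →
        let r′∈ = stays s ¬occ
            Tₑ′ , mₑ , p = reply r′ r′∈ s (¬occ ∘ placement-occupied {T})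
            next = follow r′∈ s mₑ
        in cops-move (placement (proj₁ ∘ next)) (placement-moves {T} (proj₁ ∘ proj₂ ∘ next))
             (playout {T = proj₁ ∘ next} r′∈ (λ {e′} → proj₁ (proj₂ (proj₂ (next e′))))
               (proj₂ (proj₂ (proj₂ (next e))) refl) p win)
        where
        stays : ∀ {r′} → Step G r r′ → ¬ Occupied G (placement T) r′ → r′ ∈ R S
        stays {r′} s ¬occ with r′ ∈? R S
        ... | yes r′∈ = r′∈
        stays (inj₁ refl) ¬occ | no r∉ = ⊥-elim (r∉ r∈)
        stays {r′} (inj₂ rr) ¬occ | no r′∉ with border r∈ r′∉ rr
        ... | inj₁ w = ⊥-elim (¬occ (placement-occupied {T} (safe w (inj₂ rr))))
        ... | inj₂ (e′ , e′≢e , g) = ⊥-elim (¬occ (placement-occupied {T}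
          (guards-occupied (duty S e′) (valid S e′) r∈ (others e′≢e) g (inj₂ rr))))

        follow : ∀ {r′ Tₑ′} → r′ ∈ R S → Step G r r′ → TeamMoves (T e) Tₑ′ → ∀ e′ →
          ∃ λ T′ → TeamMoves (T e′) T′ × (e′ ≢ e → Keeps (duty S e′) T′ r′) × (e′ ≡ e → T′ ≡ Tₑ′)
        follow {Tₑ′ = Tₑ′} r′∈ s mₑ e′ with e′ Fin.≟ e
        ... | yes refl = Tₑ′ , mₑ , (λ e≢e → ⊥-elim (e≢e refl)) , λ _ → refl
        ... | no e′≢e with follows (duty S e′) (valid S e′) r∈ r′∈ s (others e′≢e)
        ...   | T′ , ms , keeps = T′ , ms , (λ _ → keeps) , ⊥-elim ∘ e′≢e

    -- A transition to a new state in which only team `e` gets a new duty; the other duties are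
    -- merely restricted to the smaller territory.
    record Change : Set where
      field
        R′          : Subset n
        R′⊆         : ∀ {v} → v ∈ R′ → v ∈ R S
        R-connected : ConnectedOn G (_∈ R′)
        lab         : Labelling
        unlabelled  : ∀ {v} → v ∈ R′ → lab v ≡ none
        bags        : ∀ x → ConnectedOn G (λ v → lab v ≡ bag x)
        others      : ∀ {e′} → e′ ≢ e → Valid lab e′ (duty S e′)
        new         : Duty R′
        new-valid   : Valid lab e new
        border      : ∀ {u v} → u ∈ R′ → v ∉ R′ → G [ u ~ v ] → Guards new v ⊎ OtherGuards v

    module _ (C : Change) where
      private module C = Change C

      private
        old : Fin m → Duty C.R′
        old = restrictDuty C.R′⊆ ∘ duty S

      change : State
      change = record
        { R = C.R′ ; R-connected = C.R-connected ; lab = C.lab ; unlabelled = C.unlabelled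
        ; bags = C.bags ; duty = updateAt old e (const C.new)
        ; valid = updateAt-elim (Valid C.lab) old C.new-valid
            λ {e′} e′≢e → restrict-valid C.R′⊆ (duty S e′) (C.others e′≢e)
        ; boundary = boundary′ }
        where
        boundary′ : ∀ {u v} → u ∈ C.R′ → v ∉ C.R′ → G [ u ~ v ] →
                    ∃ λ e′ → Guards (updateAt old e (const C.new) e′) v
        boundary′ {v = v} u∈ v∉ uv with C.border u∈ v∉ uv
        ... | inj₁ g = e , subst (λ s → Guards s v) (sym (updateAt-updates e old)) g
        ... | inj₂ (e′ , e′≢e , g) = e′ ,
          subst (λ s → Guards s v) (sym (updateAt-minimal e′ e old e′≢e))
            (restrict-guards C.R′⊆ (duty S e′) g)

      change-good : Good change → ∀ {T r} → r ∈ C.R′ → OthersKeep T r → Keeps C.new (T e) r →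
                    RobberLoses T r
      change-good good {T} {r} r∈ others keeps = good r∈
        (updateAt-elim (λ e′ s → Keeps s (T e′) r) old keeps
          λ {e′} e′≢e → restrict-keeps C.R′⊆ (duty S e′) (others e′≢e))

      change-smaller : size C.new < size (duty S e) → ∣ C.R′ ∣ ≡ ∣ R S ∣ → change ≺ S
      change-smaller s< same = inj₂ (same , total-decreases e
        (subst (_< size (duty S e)) (cong size (sym (updateAt-updates e old))) s<)
        λ e′ e′≢e → trans (cong size (updateAt-minimal e′ e old e′≢e))
                          (restrict-size C.R′⊆ (duty S e′)))

      change-shrinks : ∀ {q} → q ∈ R S → q ∉ C.R′ → change ≺ S
      change-shrinks q∈ q∉ = inj₁ (p⊂q⇒∣p∣<∣q∣ (C.R′⊆ , _ , q∈ , q∉))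

  -- Changing labels

  assign : Labelling → Fin n → Fin k → Labelling
  assign lab q x v with v Fin.≟ q
  ... | yes _ = bag x
  ... | no _  = lab v

  assign-at : ∀ lab q x → assign lab q x q ≡ bag x
  assign-at lab q x with q Fin.≟ q
  ... | yes _  = refl
  ... | no q≢q = ⊥-elim (q≢q refl)

  assign-off : ∀ lab {q x v} → v ≢ q → assign lab q x v ≡ lab v
  assign-off lab {q} {v = v} v≢q with v Fin.≟ q
  ... | yes v≡q = ⊥-elim (v≢q v≡q)
  ... | no _    = refl

  -- What keeps the bag of `x` connected when `q` is added: a neighbour in the bag, or an empty bag,
  -- which `q` then founds.
  Attached : Labelling → Fin n → Fin k → Set
  Attached lab q x = (∃ λ w → lab w ≡ bag x × G [ w ~ q ]) ⊎ (∀ w → lab w ≢ bag x)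

  module _ {lab : Labelling} {q : Fin n} (unbagged : ∀ y → lab q ≢ bag y) {x : Fin k} where

    assign-bag : ∀ {v y} → lab v ≡ bag y → assign lab q x v ≡ bag y
    assign-bag {v} {y} eq = trans (assign-off lab λ { refl → unbagged y eq }) eq

    assign-bags : Attached lab q x → (∀ y → ConnectedOn G (λ v → lab v ≡ bag y)) →
                  ∀ y → ConnectedOn G (λ v → assign lab q x v ≡ bag y)
    assign-bags attached conn y with y Fin.≟ x
    ... | yes refl = connectedOn-insert G {P = λ v → lab v ≡ bag y} (conn y) assign-bag
      (assign-at lab q x) (λ eq v≢q → trans (sym (assign-off lab v≢q)) eq) attached
    ... | no y≢x = λ eu ev → within-mono G {P = λ v → lab v ≡ bag y} assign-bag (conn y (old eu) (old ev))
      where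
      old : ∀ {v} → assign lab q x v ≡ bag y → lab v ≡ bag y
      old {v} eq with v Fin.≟ q
      ... | yes refl = ⊥-elim (y≢x (bag-injective (sym eq)))
      ... | no _     = eq

  paint : Labelling → {I : Pred (Fin n) 0ℓ} → Decidable I → Fin m → Labelling
  paint lab I? e v with I? v
  ... | yes _ = inner e
  ... | no _  = lab v

  module _ {lab : Labelling} {I : Pred (Fin n) 0ℓ} (I? : Decidable I) {e : Fin m} where

    paint-on : ∀ {v} → I v → paint lab I? e v ≡ inner e
    paint-on {v} iv with I? v
    ... | yes _  = refl
    ... | no ¬iv = ⊥-elim (¬iv iv)

    paint-off : ∀ {v} → ¬ I v → paint lab I? e v ≡ lab v
    paint-off {v} ¬iv with I? v
    ... | yes iv = ⊥-elim (¬iv iv)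
    ... | no _   = refl

    paint-bag : ∀ {v x} → paint lab I? e v ≡ bag x → lab v ≡ bag x
    paint-bag {v} eq with I? v
    paint-bag {v} () | yes _
    ... | no _ = eq

  clear : Labelling → Fin k → Labelling
  clear lab x v with bag? (lab v) x
  ... | yes _ = none
  ... | no _  = lab v

  module _ (lab : Labelling) (x : Fin k) where

    clear-other : ∀ {v} → lab v ≢ bag x → clear lab x v ≡ lab v
    clear-other {v} other with bag? (lab v) x
    ... | yes eq = ⊥-elim (other eq)
    ... | no _   = refl

    clear-none : ∀ {v} → lab v ≡ none → clear lab x v ≡ none
    clear-none {v} eq with bag? (lab v) x
    ... | yes _ = refl
    ... | no _  = eq

    clear-cleared : ∀ v → clear lab x v ≢ bag x
    clear-cleared v eq with bag? (lab v) x
    clear-cleared v () | yes _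
    ... | no other = other eq

    clear-bag : ∀ {v y} → clear lab x v ≡ bag y → lab v ≡ bag y
    clear-bag {v} eq with bag? (lab v) x
    clear-bag {v} () | yes _
    ... | no _ = eq

  -- Trimming duties that no longer touch the territory

  module _ (S : State) (e : Fin m) where
    private module S = State S

    split-boundary : ∀ {u v} → u ∈ S.R → v ∉ S.R → G [ u ~ v ] → Guards (S.duty e) v ⊎ OtherGuards S e v
    split-boundary u∈ v∉ uv with S.boundary u∈ v∉ uv
    ... | e′ , g with e′ Fin.≟ e
    ...   | yes refl = inj₁ g
    ...   | no e′≢e  = inj₂ (e′ , e′≢e , g)

    -- The territory stays the same, so only guarded vertices adjacent to it have to remain guarded.
    refit : (lab : Labelling) → (∀ {v} → v ∈ S.R → lab v ≡ none) →
      (∀ x → ConnectedOn G (λ v → lab v ≡ bag x)) →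
      (∀ {e′} → e′ ≢ e → Valid lab e′ (S.duty e′)) →
      (new : Duty S.R) → Valid lab e new →
      (∀ {v} → Adjacent {S.R} v → Guards (S.duty e) v → Guards new v) → Change S e
    refit lab unlabelled bags others new new-valid enough = record
      { R′ = S.R ; R′⊆ = id ; R-connected = S.R-connected ; lab = lab ; unlabelled = unlabelled
      ; bags = bags ; others = others ; new = new ; new-valid = new-valid
      ; border = λ u∈ v∉ uv → [ inj₁ ∘ enough (_ , u∈ , ~-sym G uv) , inj₂ ] (split-boundary u∈ v∉ uv) }

    refit-same : (new : Duty S.R) → Valid (S.lab) e new →
      (∀ {v} → Adjacent {S.R} v → Guards (S.duty e) v → Guards new v) → Change S e
    refit-same = refit S.lab S.unlabelled S.bags λ _ → S.valid _

    module _ (smaller-good : ∀ S′ → S′ ≺ S → Good S′) where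

      release : ∀ {z} → S.duty e ≡ thin z → ¬ Adjacent {S.R} z → Good S
      release {z} eq ¬adj {T} r∈ keeps =
        change-good S e C (smaller-good (change S e C) (change-smaller S e C smaller refl)) {T} r∈ (λ _ → keeps _) tt
        where
        C : Change S e
        C = refit-same free tt λ {v} adj g →
          ⊥-elim (¬adj (subst Adjacent (subst (λ s → Guards s v) eq g) adj))

        smaller : 0 < size (S.duty e)
        smaller = subst (λ s → 0 < size s) (sym eq) ℕ.≤-refl

      module _ {P i j} (eq : S.duty e ≡ thick P i j) where
        private
          open ShadowedPath P
          open ThickAt (subst (Valid S.lab e) eq (S.valid e))

          size-eq : size (S.duty e) ≡ suc (j ∸ i)
          size-eq = cong size eq

          guards-eq : ∀ {v} → Guards (S.duty e) v → ∃ λ c → i ≤ c × c ≤ j × v ≡ path c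
          guards-eq {v} = subst (λ s → Guards s v) eq

          -- `path c` is to become an end of the stretch and passes from the interior to the bag of
          -- `x`. No cop has to move, since `Keeps` refers to the whole path and not to `i` and `j`.
          absorb : ∀ {c x i′ j′} → i < c → c < j →
            (∃ λ w → S.lab w ≡ bag x × G [ w ~ path c ]) → j′ ∸ i′ < j ∸ i →
            ThickAt (assign S.lab (path c) x) e P i′ j′ →
            (∀ {v} → Adjacent {S.R} v → Guards (thick P i j) v → Guards (thick P i′ j′) v) → Good S
          absorb {c} {x} {i′} {j′} i<c c<j attached shorter va enough {T} {r} r∈ keeps =
            change-good S e C (smaller-good (change S e C) (change-smaller S e C
                (subst (suc (j′ ∸ i′) <_) (sym size-eq) (s≤s shorter)) refl))
              {T} r∈ (λ _ → keeps _) (subst (λ s → Keeps s (T e) r) eq (keeps e))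
            where
            was-inner : S.lab (path c) ≡ inner e
            was-inner = interior i<c c<j

            unbagged : ∀ y → S.lab (path c) ≢ bag y
            unbagged y bagged with trans (sym was-inner) bagged
            ... | ()

            C : Change S e
            C = refit (assign S.lab (path c) x)
              (λ v∈ → trans (assign-off S.lab λ { refl → disjoint (ℕ.≤-trans (ℕ.<⇒≤ c<j) j≤len) v∈ })
                            (S.unlabelled v∈))
              (assign-bags unbagged (inj₁ attached) S.bags)
              (λ {e′} e′≢e → valid-mono (S.duty e′) (assign-bag {S.lab} unbagged)
                (λ inner-e′ → trans (assign-off S.lab λ { refl →
                  e′≢e (inner-injective (trans (sym inner-e′) was-inner)) }) inner-e′) (S.valid e′))
              (thick P i′ j′) va λ adj g → enough adj (guards-eq g)
              where
              inner-injective : ∀ {e₁ e₂} → inner e₁ ≡ inner e₂ → e₁ ≡ e₂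
              inner-injective refl = refl

          -- Only `path c` still touches the territory, so the team collapses onto it. A stretch has
          -- at least two vertices, hence `size` falls.
          thin-down : ∀ {c} → c ≤ len → ThinAt S.lab e (path c) →
            (∀ {v} → Adjacent {S.R} v → Guards (thick P i j) v → v ≡ path c) → Good S
          thin-down {c} c≤ va enough {T} {r} r∈ keeps =
            playout S e (Change.border C) r∈ (λ _ → keeps _) refl
              (OnPath.collapse P disjoint c≤ r∈ (subst (λ s → Keeps s (T e) r) eq (keeps e)))
              λ {T} r∈ others (at , _) → change-good S e C
                (smaller-good (change S e C) (change-smaller S e C (subst (1 <_) (sym size-eq)
                  (s≤s (ℕ.m<n⇒0<n∸m i<j))) refl)) {T} r∈ others at
            where
            C : Change S e
            C = refit-same (thin (path c)) va λ adj g → enough adj (guards-eq g)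

          apart : ∀ {a b} → a < b → b ≤ j → path a ≢ path b
          apart a<b b≤j eq = ℕ.<⇒≢ a<b (path-injective
            (ℕ.≤-trans (ℕ.<⇒≤ a<b) (ℕ.≤-trans b≤j j≤len)) (ℕ.≤-trans b≤j j≤len) eq)

          swap-ends : ∀ {a b} → Ends e a b → Ends e b a
          swap-ends (inj₁ p) = inj₂ p
          swap-ends (inj₂ p) = inj₁ p

        -- `path (suc i)` either is an interior vertex, which joins the bag of `left`, or is the
        -- right end, which alone remains to be guarded.
        trim-left : ¬ Adjacent {S.R} (path i) → Good S
        trim-left ¬adj = [ (λ 1+i<j → absorb (ℕ.n<1+n i) 1+i<j
                             (path i , left-bag , path-step (ℕ.≤-trans i<j j≤len))
                             (ℕ.∸-monoʳ-< (ℕ.n<1+n i) i<j)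
                             (thick-at 1+i<j j≤len disjoint ends-of (assign-at S.lab (path (suc i)) _)
                               (trans (assign-off S.lab (apart 1+i<j ℕ.≤-refl ∘ sym)) right-bag)
                               λ 1+i<c c<j → trans (assign-off S.lab (apart 1+i<c (ℕ.<⇒≤ c<j) ∘ sym))
                                                   (interior (ℕ.<⇒≤ 1+i<c) c<j))
                             enough)
                         , (λ { refl → thin-down j≤len (thin-at (swap-ends ends-of) right-bag)
                             λ adj g → let c , i<c , c≤j , v≡ = enough adj g in
                               trans v≡ (cong path (ℕ.≤-antisym c≤j i<c)) })
                         ] (ℕ.m≤n⇒m<n∨m≡n i<j)
          where
          enough : ∀ {v} → Adjacent {S.R} v → Guards (thick P i j) v → Guards (thick P (suc i) j) v
          enough adj (c , i≤c , c≤j , refl) with ℕ.m≤n⇒m<n∨m≡n i≤c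
          ... | inj₁ i<c  = c , i<c , c≤j , refl
          ... | inj₂ refl = ⊥-elim (¬adj adj)

        trim-right : ¬ Adjacent {S.R} (path j) → Good S
        trim-right ¬adj =
          [ (λ i<j′ → absorb i<j′ j′<j
              (path j , right-bag , ~-sym G (subst (λ c → G [ path j′ ~ path c ]) 1+j′≡j (path-step j′<len)))
              (ℕ.∸-monoˡ-< j′<j i≤j′)
              (thick-at i<j′ (ℕ.<⇒≤ j′<len) disjoint ends-of
                (trans (assign-off S.lab (apart i<j′ (ℕ.<⇒≤ j′<j))) left-bag)
                (assign-at S.lab (path j′) _)
                λ i<c c<j′ → trans (assign-off S.lab (apart c<j′ (ℕ.<⇒≤ j′<j)))
                                   (interior i<c (ℕ.<-trans c<j′ j′<j)))
              enough)
          , (λ { i≡j′ → thin-down (ℕ.≤-trans (ℕ.<⇒≤ i<j) j≤len) (thin-at ends-of left-bag)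
              λ adj g → let c , i≤c , c≤j′ , v≡ = enough adj g in
                trans v≡ (cong path (ℕ.≤-antisym (subst (c ≤_) (sym i≡j′) c≤j′) i≤c)) })
          ] (ℕ.m≤n⇒m<n∨m≡n i≤j′)
          where
          j′ = j ∸ 1

          1+j′≡j : suc j′ ≡ j
          1+j′≡j = ℕ.m+[n∸m]≡n (ℕ.≤-trans (s≤s z≤n) i<j)

          below : ∀ {c} → c < j → c ≤ j′
          below = ℕ.∸-monoˡ-≤ 1

          i≤j′ : i ≤ j′
          i≤j′ = below i<j

          j′<j : j′ < j
          j′<j = ℕ.≤-reflexive 1+j′≡j

          j′<len : j′ < len
          j′<len = ℕ.≤-trans j′<j j≤len

          enough : ∀ {v} → Adjacent {S.R} v → Guards (thick P i j) v → Guards (thick P i j′) v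
          enough adj (c , i≤c , c≤j , refl) with ℕ.m≤n⇒m<n∨m≡n c≤j
          ... | inj₁ c<j  = c , i≤c , below c<j , refl
          ... | inj₂ refl = ⊥-elim (¬adj adj)

      normalise : ¬ Normal (S.duty e) → Good S
      normalise ¬normal = by-duty (S.duty e) refl
        where
        by-duty : ∀ s → S.duty e ≡ s → Good S
        by-duty free eq = ⊥-elim (¬normal (subst Normal (sym eq) tt))
        by-duty (thin z) eq = release eq (¬normal ∘ subst Normal (sym eq))
        by-duty (thick P i j) eq with adjacent? {S.R} (ShadowedPath.path P i)
        ... | no ¬adj = trim-left eq ¬adj
        ... | yes adj = trim-right eq λ adj′ → ¬normal (subst Normal (sym eq) (adj , adj′))

  -- A labelling valid for all present duties, with a vertex of `R` that can be added to the bag of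
  -- `x`. That bag itself may have been emptied, hence the restriction in `other-bags`.
  record Prepared (S : State) (x : Fin k) : Set where
    private module S = State S
    field
      lab        : Labelling
      unlabelled : ∀ {v} → v ∈ S.R → lab v ≡ none
      other-bags : ∀ {v y} → y ≢ x → S.lab v ≡ bag y → lab v ≡ bag y
      bags       : ∀ y → ConnectedOn G (λ v → lab v ≡ bag y)
      valid      : ∀ e → Valid lab e (S.duty e)
      target     : Fin n
      target∈    : target ∈ S.R
      attached   : Attached lab target x

  -- If no vertex of a bag is adjacent to R then no duty refers to it, so it can
  -- be started afresh.
  prepare : ∀ S {r} → r ∈ R S → (∀ e → Normal (duty S e)) → ∀ x → Prepared S x
  prepare S {r} r∈ normal x with any? (λ w → bag? (lab S w) x ×-dec adjacent? {R S} w)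
  ... | yes (w , w-bag , u , u∈ , wu) = record
    { lab = lab S ; unlabelled = unlabelled S ; other-bags = λ _ eq → eq ; bags = bags S
    ; valid = valid S ; target = u ; target∈ = u∈ ; attached = inj₁ (w , w-bag , wu) }
  ... | no ¬adj = record
    { lab = clear (lab S) x
    ; unlabelled = clear-none (lab S) x ∘ unlabelled S
    ; other-bags = λ y≢x eq → keep y≢x eq
    ; bags = cleared-bags
    ; valid = λ e → still-valid (duty S e) (valid S e) (normal e)
    ; target = r ; target∈ = r∈ ; attached = inj₂ (clear-cleared (lab S) x) }
    where
    keep : ∀ {v y} → y ≢ x → lab S v ≡ bag y → clear (lab S) x v ≡ bag y
    keep y≢x eq = trans (clear-other (lab S) x λ eq′ → y≢x (bag-injective (trans (sym eq) eq′))) eq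

    cleared-bags : ∀ y → ConnectedOn G (λ v → clear (lab S) x v ≡ bag y)
    cleared-bags y eu ev with y Fin.≟ x
    ... | yes refl = ⊥-elim (clear-cleared (lab S) x _ eu)
    ... | no y≢x   = within-mono G {P = λ v → lab S v ≡ bag y} (keep y≢x)
                       (bags S y (clear-bag (lab S) x eu) (clear-bag (lab S) x ev))

    keep-adjacent : ∀ {v y} → Adjacent {R S} v → lab S v ≡ bag y → clear (lab S) x v ≡ bag y
    keep-adjacent {v} adj eq = keep (λ { refl → ¬adj (v , eq , adj) }) eq

    keep-inner : ∀ {v e} → lab S v ≡ inner e → clear (lab S) x v ≡ inner e
    keep-inner eq = trans (clear-other (lab S) x λ eq′ → inner≢bag (trans (sym eq) eq′)) eq
      where
      inner≢bag : ∀ {e} → inner e ≢ bag x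
      inner≢bag ()

    still-valid : ∀ {e} s → Valid (lab S) e s → Normal s → Valid (clear (lab S) x) e s
    still-valid free _ _ = tt
    still-valid (thin z) (thin-at es hb) adj = thin-at es (keep-adjacent adj hb)
    still-valid (thick P i j) (thick-at i<j j≤ dis es lb rb int) (adjₗ , adjᵣ) =
      thick-at i<j j≤ dis es (keep-adjacent adjₗ lb) (keep-adjacent adjᵣ rb)
        λ i<c c<j → keep-inner (int i<c c<j)

  -- The step common to `occupy` and `connect`: team `e` now guards `Q`, which confines the robber
  -- to his component of `R` without `Q`. Since `target` lies in `Q`, the territory shrinks
  -- strictly; `I` is the interior of a new path.
  module Shrink (S : State) (e : Fin m) {x} (prep : Prepared S x)
                {Q : Pred (Fin n) 0ℓ} (Q? : Decidable Q)
                {I : Pred (Fin n) 0ℓ} (I? : Decidable I) (I⊆R : ∀ {v} → I v → v ∈ R S)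
                {r} (r∈ : r ∈ R S) (¬Qr : ¬ Q r) where
    private
      module S = State S
      module Pr = Prepared prep

    territory : Component G (λ v → v ∈ S.R × ¬ Q v) r
    territory = component G (λ v → v ∈? S.R ×-dec ¬? (Q? v)) (r∈ , ¬Qr)

    open Component territory

    painted : Labelling
    painted = paint Pr.lab I? e

    relabelled : Labelling
    relabelled = assign painted Pr.target x

    labelled-stays : ∀ {v l} → l ≢ none → Pr.lab v ≡ l → relabelled v ≡ l
    labelled-stays {v} l≢none eq = trans
      (assign-off painted λ { refl → v∉R Pr.target∈ }) (trans (paint-off I? (v∉R ∘ I⊆R)) eq)
      where
      v∉R : v ∉ S.R
      v∉R v∈ = l≢none (trans (sym eq) (Pr.unlabelled v∈))

    module _ (Q-target : Q Pr.target) (I⊆Q : ∀ {v} → I v → Q v)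
             (new : Duty vertices) (new-valid : Valid relabelled e new)
             (guards-old : ∀ {v} → Guards (S.duty e) v → Guards new v)
             (guards-Q : ∀ {v} → v ∈ S.R → Q v → Guards new v) where

      shrunk : Change S e
      shrunk = record
        { R′ = vertices ; R′⊆ = proj₁ ∘ inside ; R-connected = connected
        ; lab = relabelled ; unlabelled = unlabelled′
        ; bags = assign-bags unbagged attached′ painted-bags
        ; others = λ {e′} _ → valid-mono (S.duty e′) (labelled-stays λ ()) (labelled-stays λ ())
                                (Pr.valid e′)
        ; new = new ; new-valid = new-valid ; border = border }
        where
        unlabelled′ : ∀ {v} → v ∈ vertices → relabelled v ≡ none
        unlabelled′ v∈ = let v∈R , ¬Qv = inside v∈ in
          trans (assign-off painted λ { refl → ¬Qv Q-target })
            (trans (paint-off I? (¬Qv ∘ I⊆Q)) (Pr.unlabelled v∈R))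

        paint-keeps : ∀ {v y} → Pr.lab v ≡ bag y → painted v ≡ bag y
        paint-keeps {v} eq = trans (paint-off I? λ iv → none≢bag (trans (sym (Pr.unlabelled (I⊆R iv))) eq)) eq
          where
          none≢bag : ∀ {y} → none ≢ bag y
          none≢bag ()

        unbagged : ∀ y → painted Pr.target ≢ bag y
        unbagged y eq with trans (sym (Pr.unlabelled Pr.target∈)) (paint-bag I? eq)
        ... | ()

        attached′ : Attached painted Pr.target x
        attached′ with Pr.attached
        ... | inj₁ (w , w-bag , wt) = inj₁ (w , paint-keeps w-bag , wt)
        ... | inj₂ empty            = inj₂ λ w eq → empty w (paint-bag I? eq)

        painted-bags : ∀ y → ConnectedOn G (λ v → painted v ≡ bag y)
        painted-bags y eu ev = within-mono G {P = λ v → Pr.lab v ≡ bag y} paint-keeps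
          (Pr.bags y (paint-bag I? eu) (paint-bag I? ev))

        border : ∀ {u v} → u ∈ vertices → v ∉ vertices → G [ u ~ v ] → Guards new v ⊎ OtherGuards S e v
        border {u} {v} u∈ v∉ uv with v ∈? S.R
        ... | no v∉R = [ inj₁ ∘ guards-old , inj₂ ] (split-boundary S e (proj₁ (inside u∈)) v∉R uv)
        ... | yes v∈R with Q? v
        ...   | yes Qv = inj₁ (guards-Q v∈R Qv)
        ...   | no ¬Qv = ⊥-elim (v∉ (closed u∈ (v∈R , ¬Qv) uv))

      shrink-good : (∀ S′ → S′ ≺ S → Good S′) → ∀ {T} → OthersKeep S e T r → Keeps new (T e) r →
                    RobberLoses T r
      shrink-good smaller-good {T} others keeps =
        change-good S e shrunk (smaller-good (change S e shrunk)
          (change-shrinks S e shrunk Pr.target∈ λ t∈ → proj₂ (inside t∈) Q-target)) {T} root∈ others keeps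

  -- Occupying a vertex and connecting two bags

  module _ (S : State) (e : Fin m) (normal : ∀ e′ → Normal (duty S e′))
           (smaller-good : ∀ S′ → S′ ≺ S → Good S′) where
    private module S = State S

    -- A free team guards nothing and can walk to `target` undisturbed; the vertex joins the bag of
    -- the first end of `e`.
    occupy : S.duty e ≡ free → Good S
    occupy eq {T} {r} r∈ keeps = playout S e border r∈ (λ _ → keeps _) refl (gather p λ ())
      λ {T} {r} r∈ others (at , r≢p) →
        Shrink.shrink-good S e prep (Fin._≟ p) {I = λ _ → ⊥} (λ _ → no id) ⊥-elim r∈ r≢p refl ⊥-elim
          (thin p) (thin-at (inj₁ refl) (assign-at _ p x)) (λ g → ⊥-elim (guards-nothing g)) (λ _ v≡p → v≡p)
          smaller-good {T} others at
      where
      x : Fin k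
      x = proj₁ (ends e)

      prep : Prepared S x
      prep = prepare S r∈ normal x

      p : Fin n
      p = Prepared.target prep

      guards-nothing : ∀ {v} → ¬ Guards (S.duty e) v
      guards-nothing {v} = subst (λ s → Guards s v) eq

      border : ∀ {u v} → u ∈ S.R → v ∉ S.R → G [ u ~ v ] → ⊥ ⊎ OtherGuards S e v
      border u∈ v∉ uv = [ inj₁ ∘ guards-nothing , inj₂ ] (split-boundary S e u∈ v∉ uv)

    -- Normality makes `z` adjacent to `R`, so a geodesic leads from `z` through `R` to a vertex
    -- that joins the bag of the other end. With `W` consisting of `z`, the old guard is kept until
    -- the new one stands.
    connect : ∀ {z} → S.duty e ≡ thin z → Good S
    connect {z} eq {T} {r} r∈ keeps
      with subst (Valid S.lab e) eq (S.valid e) | subst Normal eq (normal e)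
    ... | thin-at {home} {away} es z-home | u₀ , u₀∈ , zu₀ =
      playout S e border r∈ (λ _ → keeps _) refl
        (extend-guard (λ { refl → sym start }) (z∉R ∘ subst (_∈ S.R) start) r∈
          λ j → trans (at-z j) (sym start)) win
      where
      at-z : ∀ j → T e j ≡ z
      at-z = subst (λ s → Keeps s (T e) r) eq (keeps e)

      z∉R : z ∉ S.R
      z∉R = S.labelled⇒∉R z-home

      prep : Prepared S away
      prep = prepare S r∈ normal away
      module Pr = Prepared prep

      P : ShadowedPath G (_∈ S.R)
      P = geodesic G (_∈? S.R) S.R-connected z∉R u₀∈ zu₀ Pr.target∈
      open ShadowedPath P
      open OnPath P

      start : path 0 ≡ z
      start = geodesic-start G (_∈? S.R) S.R-connected z∉R u₀∈ zu₀ Pr.target∈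

      end : path len ≡ Pr.target
      end = geodesic-end G (_∈? S.R) S.R-connected z∉R u₀∈ zu₀ Pr.target∈

      inR : ∀ {c} → 0 < c → c ≤ len → path c ∈ S.R
      inR = geodesic-inside G (_∈? S.R) S.R-connected z∉R u₀∈ zu₀ Pr.target∈

      0<len : 0 < len
      0<len = ℕ.n≢0⇒n>0 λ len≡0 → z∉R (subst (_∈ S.R)
        (trans (sym end) (trans (cong path len≡0) start)) Pr.target∈)

      border : ∀ {u v} → u ∈ S.R → v ∉ S.R → G [ u ~ v ] → v ≡ z ⊎ OtherGuards S e v
      border {v = v} u∈ v∉ uv =
        [ inj₁ ∘ subst (λ s → Guards s v) eq , inj₂ ] (split-boundary S e u∈ v∉ uv)

      -- `Q` is the whole path and `I` its interior; the strict bounds suit `anyUpTo?`.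
      Q I : Pred (Fin n) 0ℓ
      Q v = ∃ λ c → c < suc len × v ≡ path c
      I v = ∃ λ c → c < len × 0 < c × v ≡ path c

      Q? : Decidable Q
      Q? v = anyUpTo? (λ c → v Fin.≟ path c) (suc len)

      I? : Decidable I
      I? v = anyUpTo? (λ c → 0 <? c ×-dec v Fin.≟ path c) len

      I⊆R : ∀ {v} → I v → v ∈ S.R
      I⊆R (c , c<len , 0<c , refl) = inR 0<c (ℕ.<⇒≤ c<len)

      win : ∀ {T r} → r ∈ S.R → OthersKeep S e T r → OnStation (T e) r × OffPath r → RobberLoses T r
      win {T} {r} r∈ others (on , off) = shrink-good (len , ℕ.≤-refl , sym end)
        (λ (c , c<len , _ , v≡) → c , ℕ.m≤n⇒m≤1+n c<len , v≡)
        new new-valid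
        (λ {v} g → 0 , z≤n , z≤n , trans (subst (λ s → Guards s v) eq g) (sym start))
        (λ _ (c , c≤len , v≡) → c , z≤n , s≤s⁻¹ c≤len , v≡)
        smaller-good {T} others on
        where
        open Shrink S e prep Q? I? I⊆R r∈ (λ (c , c≤len , r≡) → off (s≤s⁻¹ c≤len) r≡)
        open Component territory

        new : Duty vertices
        new = thick (restrict (proj₁ ∘ inside) P) 0 len

        new-valid : Valid relabelled e new
        new-valid = thick-at 0<len ℕ.≤-refl
          (λ {c} c≤ v∈ → proj₂ (inside v∈) (c , s≤s c≤ , refl)) es
          -- The bag of `home` survives a restart of the bag of `away` because the two ends differ.
          (trans (cong relabelled start) (labelled-stays (λ ()) (Pr.other-bags (ends-distinct es) z-home)))
          (trans (cong relabelled end) (assign-at painted Pr.target away))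
          λ {c} 0<c c<len → trans
            (assign-off painted λ eq → ℕ.<⇒≢ c<len
              (path-injective (ℕ.<⇒≤ c<len) ℕ.≤-refl (trans eq (sym end))))
            (paint-on I? (c , c<len , 0<c , refl))

  -- Induction over the states

  Thick : ∀ {R} → Duty R → Set
  Thick (thick _ _ _) = ⊤
  Thick _             = ⊥

  thick? : ∀ {R} → Decidable (Thick {R})
  thick? free          = no id
  thick? (thin _)      = no id
  thick? (thick _ _ _) = yes tt

  Saturated : State → Set
  Saturated S = ∀ e → Normal (duty S e) × Thick (duty S e)

  module _ (unsaturated : ∀ S {r} → r ∈ R S → ¬ Saturated S) where

    -- Duties that are not normal are trimmed first, because `prepare` needs all of them normal.
    -- Then a duty that is not thick is raised, and one exists because no state is saturated.
    good : ∀ S → Good S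
    good S = go S (≺-wellFounded S)
      where
      go : ∀ S → Acc _≺_ S → Good S
      go S (acc rs) r∈ with any? (λ e → ¬? (normal? (duty S e)))
      ... | yes (e , ¬normal) = normalise S e (λ S′ S′≺S → go S′ (rs S′≺S)) ¬normal r∈
      ... | no all-normal with any? (λ e → ¬? (thick? (duty S e)))
      ...   | no all-thick = ⊥-elim (unsaturated S r∈ λ e →
        decidable-stable (normal? (duty S e)) (λ ¬normal → all-normal (e , ¬normal)) ,
        decidable-stable (thick? (duty S e)) λ ¬thick → all-thick (e , ¬thick))
      ...   | yes (e , ¬thick) = by-duty (duty S e) refl r∈
        where
        normal : ∀ e → Normal (duty S e)
        normal e = decidable-stable (normal? (duty S e)) λ ¬normal → all-normal (e , ¬normal)

        by-duty : ∀ s → duty S e ≡ s → Good S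
        by-duty free eq = occupy S e normal (λ S′ S′≺S → go S′ (rs S′≺S)) eq
        by-duty (thin z) eq = connect S e normal (λ S′ S′≺S → go S′ (rs S′≺S)) eq
        by-duty (thick P i j) eq = ⊥-elim (¬thick (subst Thick (sym eq) tt))

    initial : State
    initial = record
      { R = Subset.⊤ ; R-connected = λ _ _ → gmap id (λ uv → ∈⊤ , ∈⊤ , uv) (conn _ _)
      ; lab = λ _ → none ; unlabelled = λ _ → refl ; bags = λ x () ; duty = λ _ → free
      ; valid = λ _ → tt ; boundary = λ _ v∉ → ⊥-elim (v∉ ∈⊤) }

    strategy : Fin n → CopsHaveWinningStrategy G (t * m)
    -- All teams start free, so any placement will do. The cops pass once because `Good` speaks of
    -- positions with the robber to move.
    strategy v = placement (λ _ _ → v) , λ r _ → cops-move _ (λ _ → inj₁ refl)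
      (good initial {λ _ _ → v} ∈⊤ λ _ → tt)

-- Minors from saturated states

edge-index : ∀ {k} {H : Graph k} {x y} → H [ x ~ y ] →
             ∃ λ e → List.lookup (edges H) e ≡ (x , y) ⊎ List.lookup (edges H) e ≡ (y , x)
edge-index {H = H} {x} {y} xy = by-order (Fin.<-cmp x y)
  where
  listed : ∀ {x y} → x Fin.< y → H [ x ~ y ] → (x , y) List.∈ edges H
  listed x<y xy = ∈-filter⁺ _ (∈-cartesianProduct⁺ (∈-allFin _) (∈-allFin _)) (x<y , xy)

  by-order : Tri (x Fin.< y) (x ≡ y) (y Fin.< x) → _
  by-order (tri≈ _ refl _) = ⊥-elim (~-irrefl H xy)
  by-order (tri< x<y _ _)  = let e∈ = listed x<y xy in index e∈ , inj₁ (sym (lookup-index e∈))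
  by-order (tri> _ _ y<x)  = let e∈ = listed y<x (~-sym H xy) in index e∈ , inj₂ (sym (lookup-index e∈))

edges-loopless : ∀ {k} (H : Graph k) e →
                 proj₁ (List.lookup (edges H) e) ≢ proj₂ (List.lookup (edges H) e)
edges-loopless {k} H e eq = Fin.<-irrefl eq (proj₁ (proj₂ (∈-filter⁻
  (λ p → (proj₁ p Fin.<? proj₂ p) ×-dec _~?_ H (proj₁ p) (proj₂ p))
  {xs = List.cartesianProduct (allFin k) (allFin k)} (∈-lookup {xs = edges H} e))))

-- If `h` were the only neighbour allowed, the duplicate-free list of neighbours of `v` would be
-- empty or consist of `h` alone, so the degree would be 0, or 1 at a neighbour of `h`.
neighbour-avoiding : ∀ {k} (H : Graph k) {h v} → (H [ h ~ v ] → degree H v ≢ 1) →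
                     degree H v ≢ 0 → ∃ λ u → u ≢ h × H [ v ~ u ]
neighbour-avoiding {k} H {h} {v} ≢1 ≢0 with any? (λ u → ¬? (u Fin.≟ h) ×-dec _~?_ H v u)
... | yes found = found
... | no none = ⊥-elim (contradictory _ refl (filter⁺ (_~?_ H v) (allFin⁺ k)))
  where
  only-h : ∀ {u} → u List.∈ filter (_~?_ H v) (allFin k) → u ≡ h × H [ v ~ u ]
  only-h {u} u∈ with ∈-filter⁻ (_~?_ H v) {xs = allFin k} u∈ | u Fin.≟ h
  ... | _ , vu | yes u≡h = u≡h , vu
  ... | _ , vu | no u≢h  = ⊥-elim (none (u , u≢h , vu))

  contradictory : ∀ xs → xs ≡ filter (_~?_ H v) (allFin k) → Unique xs → ⊥
  contradictory [] eq _ = ≢0 (cong length (sym eq))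
  contradictory (u ∷ []) eq _ with only-h (subst (u List.∈_) eq (here refl))
  ... | refl , vh = ≢1 (~-sym H vh) (cong length (sym eq))
  contradictory (u ∷ w ∷ _) eq ((u≢w ∷ _) ∷ _) =
    u≢w (trans (proj₁ (only-h (subst (u List.∈_) eq (here refl))))
          (sym (proj₁ (only-h (subst (w List.∈_) eq (there (here refl)))))))

module _ {n} {G : Graph n} (conn : Connected G) {t} (F : Formation G t) {k} (H : Graph (suc k))
         (h : Fin (suc k)) (incident : ∀ x → ∃ λ y → deleteVertex H h [ x ~ y ]) where
  private
    H-h : Graph k
    H-h = deleteVertex H h

  open Strategy G conn F (List.lookup (edges H-h)) (edges-loopless H-h)

  module _ (S : State) {r} (r∈ : r ∈ State.R S) (saturated : Saturated S) where
    open State S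

    record Link (e : Fin (length (edges H-h))) : Set where
      field
        P     : ShadowedPath G (_∈ R)
        {i j} : ℕ
        at    : ThickAt lab e P i j
        adjᵢ  : Adjacent {R} (ShadowedPath.path P i)
        adjⱼ  : Adjacent {R} (ShadowedPath.path P j)
      open ShadowedPath P public
      open ThickAt at public

    link : ∀ e → Link e
    link e = from-duty (duty e) (valid e) (saturated e)
      where
      from-duty : ∀ s → Valid lab e s → Normal s × Thick s → Link e
      from-duty (thick P i j) va ((adjᵢ , adjⱼ) , _) =
        record { P = P ; at = va ; adjᵢ = adjᵢ ; adjⱼ = adjⱼ }

    private module L e = Link (link e)

    Interior : Fin (length (edges H-h)) → Pred (Fin n) 0ℓ
    Interior e v = ∃ λ c → c < L.j e × L.i e < c × v ≡ L.path e c

    interior? : ∀ e → Decidable (Interior e)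
    interior? e v = anyUpTo? (λ c → L.i e <? c ×-dec v Fin.≟ L.path e c) (L.j e)

    -- The state does not record that a vertex labelled inner e still lies on the
    -- stretch guarded for e, hence the test.
    owner : Label → Fin n → Maybe (Fin (suc k))
    owner none      v = nothing
    owner (bag x)   v = just (punchIn h x)
    owner (inner e) v with interior? e v
    ... | yes _ = just (punchIn h (L.left e))
    ... | no _  = nothing

    -- The territory is the branch set of `h`. The interior of a path goes entirely to the left end
    -- of its edge, so that the last edge of the stretch leads into the bag of the right end.
    branch : Fin n → Maybe (Fin (suc k))
    branch v with v ∈? R
    ... | yes _ = just h
    ... | no _  = owner (lab v) v

    branch-R : ∀ {v} → v ∈ R → branch v ≡ just h
    branch-R {v} v∈ with v ∈? R
    ... | yes _ = refl
    ... | no v∉ = ⊥-elim (v∉ v∈)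

    branch-bag : ∀ {v x} → lab v ≡ bag x → branch v ≡ just (punchIn h x)
    branch-bag {v} eq with v ∈? R
    ... | yes v∈ = ⊥-elim (labelled⇒∉R eq v∈)
    ... | no _ rewrite eq = refl

    branch-interior : ∀ {e c} → L.i e ≤ c → c < L.j e →
                      branch (L.path e c) ≡ just (punchIn h (L.left e))
    branch-interior {e} {c} i≤c c<j with ℕ.m≤n⇒m<n∨m≡n i≤c
    ... | inj₂ refl = branch-bag (L.left-bag e)
    ... | inj₁ i<c with L.path e c ∈? R
    ...   | yes v∈ = ⊥-elim (L.disjoint e (ℕ.≤-trans (ℕ.<⇒≤ c<j) (L.j≤len e)) v∈)
    ...   | no _ rewrite L.interior e i<c c<j with interior? e (L.path e c)
    ...     | yes _  = refl
    ...     | no out = ⊥-elim (out (c , c<j , i<c , refl))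

    data InBranch (v : Fin n) : Fin (suc k) → Set where
      territory : v ∈ R → InBranch v h
      in-bag    : ∀ {x} → lab v ≡ bag x → InBranch v (punchIn h x)
      in-path   : ∀ {e} → Interior e v → InBranch v (punchIn h (L.left e))

    in-branch : ∀ {v y} → branch v ≡ just y → InBranch v y
    in-branch {v} eq with v ∈? R
    in-branch {v} refl | yes v∈ = territory v∈
    ... | no _ = by-label (lab v) refl eq
      where
      by-label : ∀ l {y} → lab v ≡ l → owner l v ≡ just y → InBranch v y
      by-label (bag x) lab-v refl = in-bag lab-v
      by-label (inner e) lab-v eq with interior? e v
      by-label (inner e) lab-v refl | yes int = in-path int

    Branch : Fin (suc k) → Rel (Fin n) 0ℓ
    Branch y = Star (Within G (λ v → branch v ≡ just y))

    along : ∀ e d {c} → d + L.i e ≡ c → c < L.j e →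
            Branch (punchIn h (L.left e)) (L.path e c) (L.path e (L.i e))
    along e zero refl _ = ε
    along e (suc d) refl c<j =
      ( branch-interior {e} (ℕ.m≤n+m _ (suc d)) c<j
      , branch-interior {e} (ℕ.m≤n+m _ d) (ℕ.<⇒≤ c<j)
      , ~-sym G (L.path-step e (ℕ.≤-trans (ℕ.<⇒≤ c<j) (L.j≤len e)))
      ) ◅ along e d refl (ℕ.<⇒≤ c<j)

    -- An interior vertex reaches the left bag by walking back along its path. Connectedness of
    -- these branch sets thus reduces to that of the bags.
    to-bag : ∀ {x v} → InBranch v (punchIn h x) →
             ∃ λ w → lab w ≡ bag x × Branch (punchIn h x) v w
    to-bag {x} {v} b = go b refl
      where
      go : ∀ {y} → InBranch v y → y ≡ punchIn h x → ∃ λ w → lab w ≡ bag x × Branch (punchIn h x) v w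
      go (territory _) eq = ⊥-elim (punchInᵢ≢i h x (sym eq))
      go (in-bag lab-v) eq with punchIn-injective h _ _ eq
      ... | refl = v , lab-v , ε
      go (in-path {e} (c , c<j , i<c , refl)) eq with punchIn-injective h _ _ eq
      ... | refl = L.path e (L.i e) , L.left-bag e ,
                   along e (c ∸ L.i e) (ℕ.m∸n+n≡m (ℕ.<⇒≤ i<c)) c<j

    branch-connected : ∀ y → ConnectedOn G (λ v → branch v ≡ just y)
    branch-connected y bu bv with h Fin.≟ y
    ... | yes refl = within-mono G {P = _∈ R} branch-R (R-connected (in-R (in-branch bu)) (in-R (in-branch bv)))
      where
      in-R : ∀ {v} → InBranch v h → v ∈ R
      in-R {v} b = go b refl
        where
        go : ∀ {y} → InBranch v y → y ≡ h → v ∈ R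
        go (territory v∈) _  = v∈
        go (in-bag {x} _) eq = ⊥-elim (punchInᵢ≢i h x eq)
        go (in-path _)    eq = ⊥-elim (punchInᵢ≢i h _ eq)
    ... | no h≢y with punchOut h≢y | punchIn-punchOut h≢y
    ...   | x | refl =
      let u′ , u-bag , uu′ = to-bag (in-branch bu)
          v′ , v-bag , vv′ = to-bag (in-branch bv)
      in uu′ ◅◅ within-mono G {P = λ v → lab v ≡ bag x} branch-bag (bags x u-bag v-bag)
             ◅◅ reverse (λ (p , q , e) → q , p , ~-sym G e) vv′

    same-ends : ∀ {e a b x y} → Ends e a b → Ends e x y → (a ≡ x × b ≡ y) ⊎ (a ≡ y × b ≡ x)
    same-ends (inj₁ p) (inj₁ q) = inj₁ (,-injective (trans (sym p) q))
    same-ends (inj₁ p) (inj₂ q) = inj₂ (,-injective (trans (sym p) q))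
    same-ends (inj₂ p) (inj₁ q) = let b≡ , a≡ = ,-injective (trans (sym p) q) in inj₂ (a≡ , b≡)
    same-ends (inj₂ p) (inj₂ q) = let b≡ , a≡ = ,-injective (trans (sym p) q) in inj₁ (a≡ , b≡)

    -- Some edge of `H-h` ends at `x`, and the normal thick duty of its team has an end vertex in
    -- the bag of `x` next to `R`. This also shows that the bag is not empty.
    touching : ∀ x → ∃ λ w → lab w ≡ bag x × Adjacent {R} w
    touching x with edge-index {H = H-h} (proj₂ (incident x))
    ... | e , ends-xy with same-ends (L.ends-of e) ends-xy
    ...   | inj₁ (refl , _) = _ , L.left-bag e , L.adjᵢ e
    ...   | inj₂ (_ , refl) = _ , L.right-bag e , L.adjⱼ e

    Joined : Rel (Fin (suc k)) 0ℓ
    Joined x y = ∃₂ λ u v → branch u ≡ just x × branch v ≡ just y × G [ u ~ v ]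

    joined-sym : ∀ {x y} → Joined x y → Joined y x
    joined-sym (u , v , bu , bv , uv) = v , u , bv , bu , ~-sym G uv

    joined-h : ∀ x → Joined h (punchIn h x)
    joined-h x = let w , w-bag , u , u∈ , wu = touching x in
      u , w , branch-R u∈ , branch-bag w-bag , ~-sym G wu

    joined-link : ∀ e → Joined (punchIn h (L.left e)) (punchIn h (L.right e))
    joined-link e = L.path e (L.j e ∸ 1) , L.path e (L.j e) ,
      branch-interior {e} (ℕ.∸-monoˡ-≤ 1 (L.i<j e)) (ℕ.≤-reflexive 1+) , branch-bag (L.right-bag e) ,
      subst (λ c → G [ L.path e (L.j e ∸ 1) ~ L.path e c ]) 1+
        (L.path-step e (ℕ.≤-trans (ℕ.≤-reflexive 1+) (L.j≤len e)))
      where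
      1+ : suc (L.j e ∸ 1) ≡ L.j e
      1+ = ℕ.m+[n∸m]≡n (ℕ.≤-trans (s≤s z≤n) (L.i<j e))

    joined : ∀ {x y} → H [ x ~ y ] → Joined x y
    joined {x} {y} xy with h Fin.≟ x | h Fin.≟ y
    ... | yes refl | yes refl = ⊥-elim (~-irrefl H xy)
    ... | yes refl | no h≢y = subst (Joined h) (punchIn-punchOut h≢y) (joined-h _)
    ... | no h≢x | yes refl = joined-sym (subst (Joined h) (punchIn-punchOut h≢x) (joined-h _))
    ... | no h≢x | no h≢y with punchOut h≢x | punchIn-punchOut h≢x | punchOut h≢y | punchIn-punchOut h≢y
    ...   | x′ | refl | y′ | refl with edge-index {H = H-h} xy
    ...     | e , ends-xy with same-ends (L.ends-of e) ends-xy
    ...       | inj₁ (refl , refl) = joined-link e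
    ...       | inj₂ (refl , refl) = joined-sym (joined-link e)

    saturated⇒minor : H IsMinorOf G
    saturated⇒minor = model⇒minor {f = branch} record
      { inhabited = inhabited ; connected = branch-connected ; adjacent = joined }
      where
      inhabited : ∀ y → ∃ λ v → branch v ≡ just y
      inhabited y with h Fin.≟ y
      ... | yes refl = r , branch-R r∈
      ... | no h≢y   = let w , w-bag , _ = touching (punchOut h≢y) in
        w , trans (branch-bag w-bag) (cong just (punchIn-punchOut h≢y))

  teams-win : ¬ (H IsMinorOf G) → Fin n → CopsHaveWinningStrategy G (t * length (edges H-h))
  teams-win ¬minor = strategy λ S r∈ saturated → ¬minor (saturated⇒minor S r∈ saturated)

-- The bounds from teams of three and of two cops

triple : ∀ {n} (G : Graph n) → Formation G 3
triple G = record
  { role = λ { zero → behind ; (suc zero) → level ; (suc (suc zero)) → ahead }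
  ; rear = zero ; lead = suc (suc zero) ; rear-role = refl ; lead-role = refl
  ; cover = inj₁ (suc zero , refl) }

pair : ∀ {n} (G : Graph n) → Bipartite G → Formation G 2
pair G bip = record
  { role = λ { zero → behind ; (suc zero) → ahead }
  ; rear = zero ; lead = suc zero ; rear-role = refl ; lead-role = refl
  ; cover = inj₂ bip }

copNumber-bound : ∀ {k n t} (H : Graph (suc k)) (h : Fin (suc k)) (G : Graph n) →
  (∀ v → H [ h ~ v ] → degree H v ≢ 1) → (∀ v → v ≢ h → degree H v ≢ 0) →
  Connected G → ¬ (H IsMinorOf G) → Formation G t →
  surroundingCopNumber G ≤ t * length (edges (deleteVertex H h))
-- With no vertex to place cops on, the empty team wins vacuously.
copNumber-bound {n = zero} H h G _ _ _ _ _ =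
  ℕ.≤-trans (proj₂ (surroundingCopNumber-isMinimum G) 0 ([] , λ ())) z≤n
copNumber-bound {n = suc _} H h G ≢1 ≢0 conn ¬minor F =
  proj₂ (surroundingCopNumber-isMinimum G) _ (teams-win conn F H h incident ¬minor zero)
  where
  incident : ∀ x → ∃ λ y → deleteVertex H h [ x ~ y ]
  incident x with neighbour-avoiding H (≢1 (punchIn h x)) (≢0 (punchIn h x) (punchInᵢ≢i h x))
  ... | u , u≢h , xu = punchOut (u≢h ∘ sym) ,
    subst (λ w → H [ punchIn h x ~ w ]) (sym (punchIn-punchOut (u≢h ∘ sym))) xu

theorem6p3 : ∀ {k n : ℕ} (H : Graph (suc k)) (h : Fin (suc k)) (G : Graph n) →
    (∀ v → H [ h ~ v ] → degree H v ≢ 1) →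
    (∀ v → v ≢ h → degree H v ≢ 0) →
    Connected G →
    ¬ (H IsMinorOf G) →
    (surroundingCopNumber G ≤ 3 * length (edges (deleteVertex H h))) ×
    (Bipartite G → surroundingCopNumber G ≤ 2 * length (edges (deleteVertex H h)))
theorem6p3 H h G ≢1 ≢0 conn ¬minor =
  copNumber-bound H h G ≢1 ≢0 conn ¬minor (triple G) ,
  λ bip → copNumber-bound H h G ≢1 ≢0 conn ¬minor (pair G bip)
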